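{- For every $n\geq 0$, $\Phi_N$ is a bijection from alternative tableaux of length $n$ (with the standard labeling) to permutations of $\{0,1,\dots,n\}$. Moreover, if $\sigma=\Phi_N(T)$ and $i\in\{1,\dots,n\}$, then $i$ labels: - a row of $T$ if and only if $i$ is an ascent of $\sigma$; - a column of $T$ if and only if $i$ is a descent of $\sigma$; - a free row of $T$ if and only if $i$ is an RL-minimum of $\sigma$; - a free column of $T$ if and only if $i$ is a shifted RL-maximum of $\sigma$.
   Context: Tableaux and labels: - A shape of length $n$ is a Ferrers diagram in English notation, possibly with empty rows or columns, determined by its south-east border: a path of $n$ unit south/west steps from the top-right to the bottom-left corner, where south steps are rows and west steps are columns. - A labeling by $L=\{i_1<\dots<i_n\}$ attaches $i_1,\dots,i_n$ to rows and columns in the order of their steps along this border from top-right to bottom-left; the standard labeling uses $L=\{1,\dots,n\}$. Cell $(i,j)$ (row $i$, column $j$) exists iff $i<j$. The top row has the smallest row label and the leftmost column the largest column label. - An alternative tableau is a shape with a partial filling by left and up arrows such that every cell to the left of a left arrow in its row and every cell above an up arrow in its column is empty. - A free row (column) is one with no left (up) arrow; $Free(T)$ is the set of labels of free rows and columns. $\mathcal{A}_{i,j}$ denotes tableaux with exactly $i$ free rows and $j$ free columns. - For $k\in Free(T)$, $T(k)$ is the smallest $X\subseteq L$ containing $k$ such that for every arrow cell $(i,j)$, $i\in X$ iff $j\in X$. $T[k]$ is the labeled tableau on label set $T(k)$ with rows/columns and fillings inherited from $T$. - $\operatorname{split}(T)=\{T[k]:k\in Free(T)\}$; these are packed tableaux,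 i.e. tableaux of positive length in $\mathcal{A}_{0,1}\cup\mathcal{A}_{1,0}$. - $cut_r$ and $cut_c$ delete the top row, resp. the leftmost column, keeping all other labels. Trees and forests: - A plane alternative tree is a rooted plane tree with distinct integer labels and black/white vertices such that: each white vertex has label smaller than all its descendants, and its children are black with decreasing labels left to right; each black vertex has label larger than all its descendants, and its children are white with increasing labels left to right. - $\operatorname{Tree}$ is defined recursively on labeled packed tableaux $T$. If $T\in\mathcal{A}_{1,0}$, $\operatorname{Tree}(T)$ has a white root labeled by the top row label of $T$, with subtrees $\operatorname{Tree}(U)$ for $U\in\operatorname{split}(cut_r(T))$ ordered by decreasing root labels. If $T\in\mathcal{A}_{0,1}$, $\operatorname{Tree}(T)$ has a black root labeled by the leftmost column label, with subtrees $\operatorname{Tree}(U)$ for $U\in\operatorname{split}(cut_c(T))$ ordered by increasing root labels. - $\operatorname{Forest}(T)=\{\operatorname{Tree}(U):U\in\operatorname{split}(T)\}$. Permutations: - A permutation is a word with distinct integer letters; its support is its set of letters. - $\psi$ of a one-vertex tree labeled $m$ is $m$. Otherwise $\psi(T)=\psi(T_1)\cdots\psi(T_k)\,m$, with $m$ the root label and $T_1,\dots,T_k$ the root subtrees from left to right. - For a forest $F$ with white-rooted trees $T_1,\dots,T_i$ (increasing root labels) and black-rooted trees $T'_1,\dots,T'_j$ (decreasing root labels), $\Psi(F)=\psi(T'_1)\cdots\psi(T'_j)\,0\,\psi(T_1)\cdots\psi(T_i)$. - $\Phi_N:=\Psi\circ\operatorname{Forest}$. - An RL-minimum (RL-maximum)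 is a letter smaller (larger) than all letters to its right. - Writing $w=w_1\,0\,w_2$, a shifted RL-maximum is an RL-maximum of $w_1$. - An ascent is a letter smaller than the next one, or the last letter; a descent is a letter larger than the next one. -}

module Defs where

open import Data.Nat using (ℕ; zero; suc; _∸_; _<_; _≤_; _<ᵇ_; _≡ᵇ_)
open import Data.Bool using (Bool; true; false; if_then_else_; _∧_; _∨_; not)
open import Data.List using (List; []; _∷_; _++_; map; length; upTo)
open import Data.Bool.ListAction using (any)
open import Data.List.Relation.Unary.All using (All)
open import Data.List.Relation.Unary.Unique.Propositional using (Unique)
open import Data.List.Membership.Propositional using (_∈_)
open import Data.Maybe using (Maybe; just; nothing)
open import Data.Vec using (Vec; []; _∷_)
open import Data.Fin using (Fin; toℕ)
open import Data.Product using (Σ; _×_; ∃)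
open import Relation.Binary.PropositionalEquality using (_≡_; _≢_)
open import Function.Bundles using (_⇔_)

-- Alternative tableaux of length n with the standard labeling {1..n}.
-- Step t (t : Fin n) of the south-east border carries label (toℕ t + 1);
-- shape ! t = true  means a south step (a row),
-- shape ! t = false means a west step (a column).
-- fill ! i ! j is the content of the position (row label i+1, column
-- label j+1); it is only meaningful when that cell exists.

data Arrow : Set where
  emp left up : Arrow

lookupV : ∀ {A : Set} {n} → Vec A n → Fin n → A
lookupV (x ∷ xs) Fin.zero    = x
lookupV (x ∷ xs) (Fin.suc i) = lookupV xs i

entry : ∀ {n} → Vec (Vec Arrow n) n → Fin n → Fin n → Arrow
entry f i j = lookupV (lookupV f i) j

CellExists : ∀ {n} → Vec Bool n → Fin n → Fin n → Set
CellExists s i j = (lookupV s i ≡ true) × (lookupV s j ≡ false) × (toℕ i < toℕ j)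

record AltTableau (n : ℕ) : Set where
  field
    shape : Vec Bool n
    fill  : Vec (Vec Arrow n) n
    onCells : ∀ i j → entry fill i j ≢ emp → CellExists shape i j
    -- every cell to the left of a left arrow (same row, larger column label) is empty
    leftOK  : ∀ i j j' → entry fill i j ≡ left → toℕ j < toℕ j' → entry fill i j' ≡ emp
    -- every cell above an up arrow (same column, smaller row label) is empty
    upOK    : ∀ i i' j → entry fill i j ≡ up → toℕ i' < toℕ i → entry fill i' j ≡ emp
open AltTableau public

-- row / column / free row / free column of a label (given as Fin n, label toℕ i + 1)
IsRow : ∀ {n} → AltTableau n → Fin n → Set
IsRow T i = lookupV (shape T) i ≡ true

IsCol : ∀ {n} → AltTableau n → Fin n → Set
IsCol T i = lookupV (shape T) i ≡ false

IsFreeRow : ∀ {n} → AltTableau n → Fin n → Set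
IsFreeRow T i = IsRow T i × (∀ j → entry (fill T) i j ≢ left)

IsFreeCol : ∀ {n} → AltTableau n → Fin n → Set
IsFreeCol T j = IsCol T j × (∀ i → entry (fill T) i j ≢ up)

-- General labeled tableaux (label set a sublist of ℕ, in increasing order),
-- with rows/columns and fillings inherited from an ambient tableau.

record LT : Set where
  constructor lt
  field
    labels : List ℕ
    isRowL : ℕ → Bool
    arr    : ℕ → ℕ → Arrow
open LT

filterᵇ : ∀ {A : Set} → (A → Bool) → List A → List A
filterᵇ p [] = []
filterᵇ p (x ∷ xs) = if p x then x ∷ filterᵇ p xs else filterᵇ p xs

mem : ℕ → List ℕ → Bool
mem x xs = any (λ y → x ≡ᵇ y) xs

isEmp isLeft isUp : Arrow → Bool
isEmp emp = true
isEmp _ = false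
isLeft left = true
isLeft _ = false
isUp up = true
isUp _ = false

arrowAt : LT → ℕ → ℕ → Arrow
arrowAt T i j =
  if mem i (labels T) ∧ mem j (labels T) ∧ isRowL T i ∧ not (isRowL T j) ∧ (i <ᵇ j)
  then arr T i j else emp

hasArrow : LT → ℕ → ℕ → Bool
hasArrow T i j = not (isEmp (arrowAt T i j))

isFree : LT → ℕ → Bool
isFree T k = if isRowL T k
  then not (any (λ j → isLeft (arrowAt T k j)) (labels T))
  else not (any (λ i → isUp (arrowAt T i k)) (labels T))

Free : LT → List ℕ
Free T = filterᵇ (isFree T) (labels T)

-- T(k): least X ∋ k such that for every arrow cell (i , j), i ∈ X iff j ∈ X,
-- computed as the least fixpoint by iterating the closure step
adj : LT → ℕ → ℕ → Bool
adj T a b = hasArrow T a b ∨ hasArrow T b a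

closeStep : LT → List ℕ → List ℕ
closeStep T X = filterᵇ (λ l → mem l X ∨ any (adj T l) X) (labels T)

iterate : ℕ → (List ℕ → List ℕ) → List ℕ → List ℕ
iterate zero f X = X
iterate (suc m) f X = iterate m f (f X)

comp : LT → ℕ → List ℕ
comp T k = iterate (length (labels T)) (closeStep T) (k ∷ [])

restrict : LT → List ℕ → LT
restrict T X = lt (filterᵇ (λ l → mem l X) (labels T)) (isRowL T) (arr T)

-- split(T) as a set: one representative free label per component
-- (the smallest free label of the component)
splitKeys : LT → List ℕ
splitKeys T = filterᵇ (λ k → not (any (λ k' → (k' <ᵇ k) ∧ mem k' (comp T k)) (Free T))) (Free T)

split : LT → List LT
split T = map (λ k → restrict T (comp T k)) (splitKeys T)

nFreeRows nFreeCols : LT → ℕ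
nFreeRows T = length (filterᵇ (isRowL T) (Free T))
nFreeCols T = length (filterᵇ (λ l → not (isRowL T l)) (Free T))

minL maxL : List ℕ → Maybe ℕ
minL [] = nothing
minL (x ∷ xs) with minL xs
... | nothing = just x
... | just y = just (if x <ᵇ y then x else y)
maxL [] = nothing
maxL (x ∷ xs) with maxL xs
... | nothing = just x
... | just y = just (if y <ᵇ x then x else y)

-- top row = smallest row label; leftmost column = largest column label
topRow leftCol : LT → Maybe ℕ
topRow T = minL (filterᵇ (isRowL T) (labels T))
leftCol T = maxL (filterᵇ (λ l → not (isRowL T l)) (labels T))

cutAt : ℕ → LT → LT
cutAt r T = lt (filterᵇ (λ l → not (l ≡ᵇ r)) (labels T)) (isRowL T) (arr T)

data Color : Set where
  white black : Color

data PTree : Set where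
  node : Color → ℕ → List PTree → PTree

rootLabel : PTree → ℕ
rootLabel (node _ m _) = m

rootColor : PTree → Color
rootColor (node c _ _) = c

insInc insDec : PTree → List PTree → List PTree
insInc t [] = t ∷ []
insInc t (u ∷ us) = if rootLabel t <ᵇ rootLabel u then t ∷ u ∷ us else u ∷ insInc t us
insDec t [] = t ∷ []
insDec t (u ∷ us) = if rootLabel u <ᵇ rootLabel t then t ∷ u ∷ us else u ∷ insDec t us

sortInc sortDec : List PTree → List PTree
sortInc [] = []
sortInc (t ∷ ts) = insInc t (sortInc ts)
sortDec [] = []
sortDec (t ∷ ts) = insDec t (sortDec ts)

-- Tree, with fuel (the length of the tableau suffices: each recursive call
-- is on a tableau of strictly smaller length). Inputs are packed tableaux;
-- the final branch (neither top row nor leftmost column found) is unreachable.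
treeF : ℕ → LT → PTree
treeF zero T = node white 0 []
treeF (suc f) T with (nFreeRows T ≡ᵇ 1) ∧ (nFreeCols T ≡ᵇ 0)
... | true with topRow T
...   | just r  = node white r (sortDec (map (treeF f) (split (cutAt r T))))
...   | nothing = node white 0 []
treeF (suc f) T | false with leftCol T
...   | just c  = node black c (sortInc (map (treeF f) (split (cutAt c T))))
...   | nothing = node black 0 []

Tree : LT → PTree
Tree T = treeF (length (labels T)) T

Forest : LT → List PTree
Forest T = map Tree (split T)

psi : PTree → List ℕ
psiList : List PTree → List ℕ
psi (node _ m ts) = psiList ts ++ (m ∷ [])
psiList [] = []
psiList (t ∷ ts) = psi t ++ psiList ts

isWhite : PTree → Bool
isWhite t with rootColor t
... | white = true
... | black = false

Psi : List PTree → List ℕ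
Psi F = psiList (sortDec (filterᵇ (λ t → not (isWhite t)) F))
        ++ 0 ∷ psiList (sortInc (filterᵇ isWhite F))

vget : ∀ {A : Set} {n} → A → Vec A n → ℕ → A
vget d [] _ = d
vget d (x ∷ xs) zero = x
vget d (x ∷ xs) (suc k) = vget d xs k

toLT : ∀ {n} → AltTableau n → LT
toLT {n} T = lt (map suc (upTo n))
                (λ l → vget false (shape T) (l ∸ 1))
                (λ i j → vget emp (vget (Data.Vec.replicate n emp) (fill T) (i ∸ 1)) (j ∸ 1))

PhiN : ∀ {n} → AltTableau n → List ℕ
PhiN T = Psi (Forest (toLT T))

IsPermOf : List ℕ → ℕ → Set
IsPermOf σ n = Unique σ × (∀ x → (x ∈ σ) ⇔ (x ≤ n))

Ascent : ℕ → List ℕ → Set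
Ascent x σ = (∃ λ u → σ ≡ u ++ x ∷ [])
           Data.Sum.⊎ (∃ λ u → ∃ λ y → ∃ λ v → σ ≡ u ++ x ∷ y ∷ v × x < y)
  where import Data.Sum

Descent : ℕ → List ℕ → Set
Descent x σ = ∃ λ u → ∃ λ y → ∃ λ v → σ ≡ u ++ x ∷ y ∷ v × y < x

RLmin : ℕ → List ℕ → Set
RLmin x σ = ∃ λ u → ∃ λ v → σ ≡ u ++ x ∷ v × All (x <_) v

RLmax : ℕ → List ℕ → Set
RLmax x σ = ∃ λ u → ∃ λ v → σ ≡ u ++ x ∷ v × All (_< x) v

ShiftedRLmax : ℕ → List ℕ → Set
ShiftedRLmax x σ = ∃ λ w₁ → ∃ λ w₂ → σ ≡ w₁ ++ 0 ∷ w₂ × RLmax x w₁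

{-# OPTIONS --safe #-}
module Submission where

-- Read an alternative tableau as a parent function: a row points to the column
-- of its left arrow, a column to the row of its up arrow. The two conditions on
-- arrows say that this is a function and that passing to the grandparent strictly
-- decreases a row and strictly increases a column, so the components are the
-- alternative trees. Placing 0 as a white root over the black trees makes Φ_N(T)
-- the postorder word of a forest whose first root is the minimum of the word. The
-- letters on its left form the word of a forest of the same kind for the reversed
-- order, those on its right one for the same order, so splitting at the minimum
-- inverts the map. The letter following a vertex tells its colour, and a vertex is a
-- root exactly if it precedes, in the order of its colour, all later letters.

open import Defs
open import Data.Bool using (Bool; true; false; if_then_else_; _∧_; _∨_; not; T)
open import Data.Bool.ListAction using (any)
open import Data.Bool.Properties using (T-≡; T-∧; T-∨; T-not-≡; T?)
open import Data.Empty using (⊥; ⊥-elim)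
open import Data.Fin using (Fin; toℕ; fromℕ<)
open import Data.Fin.Properties using (toℕ-fromℕ<; toℕ<n)
open import Data.List using (List; []; _∷_; _++_; map; length; upTo)
open import Data.List.Membership.Propositional using (_∈_; _∉_; find; lose)
open import Data.List.Membership.Propositional.Properties
  using (∈-++⁺ˡ; ∈-++⁺ʳ; ∈-++⁻; ∈-∃++; ∈-insert; ∈-map⁺; ∈-map⁻; ∈-upTo⁺; ∈-upTo⁻)
open import Data.List.Properties using (++-assoc; ++-identityʳ; length-++; ∷-injective; ∷-injectiveʳ)
open import Data.List.Relation.Binary.Permutation.Propositional as Perm
  using (_↭_; ↭-refl; ↭-sym; ↭-trans; prep; swap)
import Data.List.Relation.Binary.Permutation.Propositional.Properties as Permₚ
import Data.List.Relation.Binary.Permutation.Setoid.Properties as SetoidPerm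
open import Data.List.Relation.Binary.Pointwise.Base using (Pointwise; []; _∷_)
open import Data.List.Relation.Unary.All as All using (All; []; _∷_)
import Data.List.Relation.Unary.All.Properties as Allₚ
open import Data.List.Relation.Unary.AllPairs using ([]; _∷_)
open import Data.List.Relation.Unary.Any using (here; there)
open import Data.List.Relation.Unary.Any.Properties using (any⇔)
open import Data.List.Relation.Unary.Unique.Propositional using (Unique)
import Data.List.Relation.Unary.Unique.Propositional.Properties as Uniqueₚ
open import Data.Maybe using (just; nothing)
open import Data.Nat using (ℕ; zero; suc; _+_; _<_; _≤_; _<ᵇ_; _≡ᵇ_; z≤n; s≤s; z<s)
open import Data.Nat.Properties
open import Data.Product using (Σ; _×_; _,_; proj₁; proj₂; ∃)
open import Data.Sum using (_⊎_; inj₁; inj₂; [_,_]′)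
open import Data.Vec as Vec using (Vec; []; _∷_)
open import Function.Base using (_∘_; case_of_)
open import Function.Bundles using (_⇔_; mk⇔; module Equivalence)
open import Relation.Binary.Definitions using (tri<; tri≈; tri>)
open import Relation.Binary.PropositionalEquality
open import Relation.Nullary using (¬_; Dec; yes; no)

open Equivalence using (to; from)

-- The recursion of `Tree` through `split` and the cuts is followed only once, to show that its
-- output is an `Ordered` forest that `Fits` the parent function and has the free labels as its
-- roots. These properties determine a forest (`Fits-unique`). Surjectivity therefore never runs
-- `Tree` on the tableau built from a given forest: it suffices that this forest has the same
-- properties for that tableau.
--
-- The obstacle on the other side is that T(k) is a closure along arrows in both directions, while a
-- tree only knows descendants. For a free label the two agree: the root has no parent to escape to,
-- and any other upward step goes back to the unique parent through which the label was reached.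
-- Each component thus has exactly one free label, which is its extremal label, so the top row or
-- leftmost column chosen by `Tree` is the root of the parent function.
--
-- Rows and columns play mirrored roles, so nearly everything is stated for one colour `c` and the
-- order attached to it; passing to the children replaces `c` by `opp c`.

opp : Color → Color
opp white = black
opp black = white

opp-involutive : ∀ c → opp (opp c) ≡ c
opp-involutive white = refl
opp-involutive black = refl

infix 4 _<[_]_

-- The usual order for white and the reversed one for black. In both cases a vertex precedes its
-- descendants, and siblings are listed in increasing order, with respect to the order of their own
-- colour.
_<[_]_ : ℕ → Color → ℕ → Set
x <[ white ] y = x < y
x <[ black ] y = y < x

<[]-trans : ∀ c {x y z} → x <[ c ] y → y <[ c ] z → x <[ c ] z
<[]-trans white p q = <-trans p q
<[]-trans black p q = <-trans q p

<[]-irrefl : ∀ c {x} → ¬ (x <[ c ] x)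
<[]-irrefl white = <-irrefl refl
<[]-irrefl black = <-irrefl refl

<[]-asym : ∀ c {x y} → x <[ c ] y → ¬ (y <[ c ] x)
<[]-asym c p q = <[]-irrefl c (<[]-trans c p q)

<[]-flip : ∀ c {x y} → x <[ c ] y → y <[ opp c ] x
<[]-flip white p = p
<[]-flip black p = p

<[]-connex : ∀ c {x y} → x ≢ y → x <[ c ] y ⊎ y <[ c ] x
<[]-connex white {x} {y} x≢y with <-cmp x y
... | tri< p _ _ = inj₁ p
... | tri≈ _ p _ = ⊥-elim (x≢y p)
... | tri> _ _ p = inj₂ p
<[]-connex black x≢y with <[]-connex white x≢y
... | inj₁ p = inj₂ p
... | inj₂ p = inj₁ p

-- Splitting lists at a letter

module _ {A : Set} where

  split-unique : ∀ {m : A} {xs xs′ ys ys′} → m ∉ xs → m ∉ xs′ →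
                 xs ++ m ∷ ys ≡ xs′ ++ m ∷ ys′ → xs ≡ xs′ × ys ≡ ys′
  split-unique {xs = []}    {[]}    p q refl = refl , refl
  split-unique {xs = []}    {_ ∷ _} p q refl = ⊥-elim (q (here refl))
  split-unique {xs = _ ∷ _} {[]}    p q refl = ⊥-elim (p (here refl))
  split-unique {xs = x ∷ xs} {x′ ∷ xs′} p q e with x | x′ | e
  ... | _ | _ | e′ with ∷-injective e′
  ...   | refl , e″ with split-unique (p ∘ there) (q ∘ there) e″
  ...     | refl , refl = refl , refl

  locate : ∀ xs {ys u v : List A} {x} → xs ++ ys ≡ u ++ x ∷ v →
           (∃ λ v′ → xs ≡ u ++ x ∷ v′ × v ≡ v′ ++ ys) ⊎
           (∃ λ u′ → u ≡ xs ++ u′ × ys ≡ u′ ++ x ∷ v)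
  locate []       {u = u} e = inj₂ (u , refl , e)
  locate (x ∷ xs) {u = []} refl = inj₁ (xs , refl , refl)
  locate (x ∷ xs) {u = y ∷ u} e with ∷-injective e
  ... | refl , e′ with locate xs e′
  ...   | inj₁ (v′ , refl , refl) = inj₁ (v′ , refl , refl)
  ...   | inj₂ (u′ , refl , refl) = inj₂ (u′ , refl , refl)

  Unique-++⁻ : ∀ xs {ys : List A} → Unique (xs ++ ys) → Unique xs × Unique ys
  Unique-++⁻ []       u = [] , u
  Unique-++⁻ (x ∷ xs) (p ∷ u) with Unique-++⁻ xs u
  ... | ux , uy = (Allₚ.++⁻ˡ xs p ∷ ux) , uy

  Unique-disjoint : ∀ xs {ys : List A} {x} → Unique (xs ++ ys) → x ∈ xs → x ∈ ys → ⊥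
  Unique-disjoint (x ∷ xs) (p ∷ u) (here refl) q = All.lookup (Allₚ.++⁻ʳ xs p) q refl
  Unique-disjoint (x ∷ xs) (p ∷ u) (there r)   q = Unique-disjoint xs u r q

-- Ordered forests

roots : List PTree → List ℕ
roots = map rootLabel

-- The alternation and the order of siblings are one condition: the root of the
-- first tree precedes, in the order of its colour, every other letter.
data Ordered : Color → List PTree → Set where
  []   : ∀ {c} → Ordered c []
  tree : ∀ {c m us ts} → All (m <[ c ]_) (psiList us) → All (m <[ c ]_) (psiList ts) →
         Ordered (opp c) us → Ordered c ts → Ordered c (node c m us ∷ ts)

-- Postorder of a forest is inorder under the first-child, next-sibling reading: the first root
-- separates the word of its subtrees from that of its right siblings. All inductions on words use
-- this form.
psiList-∷ : ∀ {c m} us ts → psiList (node c m us ∷ ts) ≡ psiList us ++ m ∷ psiList ts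
psiList-∷ {m = m} us ts = ++-assoc (psiList us) (m ∷ []) (psiList ts)

∈-word⁻ : ∀ {c m x} us ts → x ∈ psiList (node c m us ∷ ts) →
          x ∈ psiList us ⊎ x ≡ m ⊎ x ∈ psiList ts
∈-word⁻ {c} {m} us ts x∈ with ∈-++⁻ (psiList us) (subst (_ ∈_) (psiList-∷ {c} us ts) x∈)
... | inj₁ p           = inj₁ p
... | inj₂ (here p)    = inj₂ (inj₁ p)
... | inj₂ (there p)   = inj₂ (inj₂ p)

∈-word-sub : ∀ {c m x} us ts → x ∈ psiList us → x ∈ psiList (node c m us ∷ ts)
∈-word-sub {c} us ts p = subst (_ ∈_) (sym (psiList-∷ {c} us ts)) (∈-++⁺ˡ p)

∈-word-root : ∀ {c m} us ts → m ∈ psiList (node c m us ∷ ts)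
∈-word-root {c} us ts = subst (_ ∈_) (sym (psiList-∷ {c} us ts)) (∈-insert (psiList us))

∈-word-rest : ∀ {c m x} us ts → x ∈ psiList ts → x ∈ psiList (node c m us ∷ ts)
∈-word-rest {c} us ts p = subst (_ ∈_) (sym (psiList-∷ {c} us ts)) (∈-++⁺ʳ (psiList us) (there p))

∈-roots⇒∈-word : ∀ ts {x} → x ∈ roots ts → x ∈ psiList ts
∈-roots⇒∈-word (node c m us ∷ ts) (here refl) = ∈-word-root {c} us ts
∈-roots⇒∈-word (node c m us ∷ ts) (there p)   = ∈-word-rest {c} us ts (∈-roots⇒∈-word ts p)

≺⇒∉ : ∀ c {m xs} → All (m <[ c ]_) xs → m ∉ xs
≺⇒∉ c p m∈ = <[]-irrefl c (All.lookup p m∈)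

-- The first root is the least letter of the word in the order of `c`, so equal words have the same
-- first root. It occurs once on the relevant side of each factorisation, so the words of the
-- subtrees and of the siblings agree as well.
psiList-injective : ∀ {c F G} → Ordered c F → Ordered c G → psiList F ≡ psiList G → F ≡ G
psiList-injective [] [] e = refl
psiList-injective [] (tree {c} {m} {us} {ts} _ _ _ _) e
  with subst (m ∈_) (sym e) (∈-word-root {c} us ts)
... | ()
psiList-injective (tree {c} {m} {us} {ts} _ _ _ _) [] e
  with subst (m ∈_) e (∈-word-root {c} us ts)
... | ()
psiList-injective {c} (tree {m = m} {us} {ts} a b o o′) (tree {m = m′} {us′} {ts′} a′ b′ p p′) e =
  same-root (least us′ ts′ (subst (m ∈_) e (∈-word-root {c} us ts)) a′ b′)
            (least us ts (subst (m′ ∈_) (sym e) (∈-word-root {c} us′ ts′)) a b)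
  where
  least : ∀ {x y} vs ws → x ∈ psiList (node c y vs ∷ ws) →
          All (y <[ c ]_) (psiList vs) → All (y <[ c ]_) (psiList ws) → x ≡ y ⊎ y <[ c ] x
  least vs ws x∈ q r with ∈-word⁻ {c} vs ws x∈
  ... | inj₁ x∈vs        = inj₂ (All.lookup q x∈vs)
  ... | inj₂ (inj₁ x≡y)  = inj₁ x≡y
  ... | inj₂ (inj₂ x∈ws) = inj₂ (All.lookup r x∈ws)
  same-root : m ≡ m′ ⊎ m′ <[ c ] m → m′ ≡ m ⊎ m <[ c ] m′ → node c m us ∷ ts ≡ node c m′ us′ ∷ ts′
  same-root (inj₂ q) (inj₁ refl) = ⊥-elim (<[]-irrefl c q)
  same-root (inj₂ q) (inj₂ r)    = ⊥-elim (<[]-asym c q r)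
  same-root (inj₁ refl) _
    with split-unique (≺⇒∉ c a) (≺⇒∉ c a′)
           (trans (sym (psiList-∷ {c} us ts)) (trans e (psiList-∷ {c} us′ ts′)))
  ... | e₁ , e₂ = cong₂ (λ us ts → node c m us ∷ ts) (psiList-injective o p e₁) (psiList-injective o′ p′ e₂)

minimum : ∀ c x w → Unique (x ∷ w) →
          ∃ λ xs → ∃ λ m → ∃ λ ys →
            x ∷ w ≡ xs ++ m ∷ ys × All (m <[ c ]_) xs × All (m <[ c ]_) ys
minimum c x [] _ = [] , x , [] , refl , [] , []
minimum c x (y ∷ w) (x∉ ∷ u) with minimum c y w u
... | xs , m , ys , e , a , b
  with <[]-connex c (All.lookup x∉ (subst (m ∈_) (sym e) (∈-insert xs)))
...   | inj₂ m<x = x ∷ xs , m , ys , cong (x ∷_) e , m<x ∷ a , b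
...   | inj₁ x<m = [] , x , y ∷ w , refl , [] ,
        subst (All (x <[ c ]_)) (sym e)
          (Allₚ.++⁺ (All.map (<[]-trans c x<m) a) (x<m ∷ All.map (<[]-trans c x<m) b))

-- The least letter becomes the first root, the factor on its left a forest of the opposite colour
-- below it, the factor on its right its siblings. The factors are not structural parts of `w`,
-- hence the bound `f` on the length.
psiList-surjective : ∀ f c w → length w ≤ f → Unique w → ∃ λ F → Ordered c F × psiList F ≡ w
psiList-surjective f c [] _ _ = [] , [] , refl
psiList-surjective (suc f) c (x ∷ w) (s≤s l) u with minimum c x w u
... | xs , m , ys , e , a , b
  with Unique-++⁻ xs (subst Unique e u)
     | ≤-trans (≤-reflexive (suc-injective (begin
         suc (length xs + length ys)  ≡⟨ sym (+-suc (length xs) (length ys)) ⟩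
         length xs + length (m ∷ ys)  ≡⟨ sym (length-++ xs) ⟩
         length (xs ++ m ∷ ys)        ≡⟨ cong length (sym e) ⟩
         suc (length w)               ∎))) l
  where open ≡-Reasoning
...   | ux , (_ ∷ uy) | l′
    with psiList-surjective f (opp c) xs (≤-trans (m≤m+n _ _) l′) ux
       | psiList-surjective f c ys (≤-trans (m≤n+m _ _) l′) uy
...     | us , ous , refl | ts , ots , refl =
          node c m us ∷ ts , tree a b ous ots , trans (psiList-∷ {c} us ts) (sym e)

-- Forests drawn from a colouring and a parent relation

-- `P b a` reads: `a` is the parent of `b`. Only the vertices and their children are constrained;
-- which labels are roots of the whole forest has to be known separately.
data Fits (col : ℕ → Color) (P : ℕ → ℕ → Set) : PTree → Set where
  fits : ∀ {c m us} → col m ≡ c → (∀ b → P b m ⇔ b ∈ roots us) → All (Fits col P) us →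
         Fits col P (node c m us)

module _ {col : ℕ → Color} {P : ℕ → ℕ → Set} where

  -- The order of siblings makes a list of trees determined by its set of roots, and one level down
  -- that set is given by `P`.
  Fits-unique : ∀ {c F G} → Ordered c F → Ordered c G → All (Fits col P) F → All (Fits col P) G →
                (∀ x → x ∈ roots F ⇔ x ∈ roots G) → F ≡ G
  Fits-unique [] [] _ _ _ = refl
  Fits-unique [] (tree _ _ _ _) _ _ h with from (h _) (here refl)
  ... | ()
  Fits-unique (tree _ _ _ _) [] _ _ h with to (h _) (here refl)
  ... | ()
  Fits-unique {c} (tree {m = m} {us} {ts} a b o o′) (tree {m = m′} {us′} {ts′} a′ b′ p p′)
              (fits e k φ ∷ φ′) (fits e′ k′ ψ ∷ ψ′) h = result m≡m′
    where
    m≡m′ : m ≡ m′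
    m≡m′ with to (h m) (here refl) | from (h m′) (here refl)
    ... | here q  | _       = q
    ... | there _ | here q  = sym q
    -- If each first root were a later root of the other forest, each would strictly precede the
    -- other.
    ... | there q | there r = ⊥-elim (<[]-asym c (All.lookup b (∈-roots⇒∈-word ts r))
                                                 (All.lookup b′ (∈-roots⇒∈-word ts′ q)))
    tail-roots : ∀ {n ss ss′} → n ∉ ss → (∀ x → x ∈ n ∷ ss → x ∈ n ∷ ss′) → ∀ x → x ∈ ss → x ∈ ss′
    tail-roots n∉ g x x∈ with g x (there x∈)
    ... | here refl = ⊥-elim (n∉ x∈)
    ... | there q   = q
    result : m ≡ m′ → node c m us ∷ ts ≡ node c m′ us′ ∷ ts′
    result refl = cong₂ (λ us ts → node c m us ∷ ts)
      (Fits-unique o p φ ψ (λ x → mk⇔ (to (k′ x) ∘ from (k x)) (to (k x) ∘ from (k′ x))))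
      (Fits-unique o′ p′ φ′ ψ′ (λ x → mk⇔
        (tail-roots (≺⇒∉ c b ∘ ∈-roots⇒∈-word ts) (λ y → to (h y)) x)
        (tail-roots (≺⇒∉ c b′ ∘ ∈-roots⇒∈-word ts′) (λ y → from (h y)) x)))

  -- The forest can be read back: it displays the colour and the children of each of its letters.
  -- This is how two tableaux with the same forest are compared.
  Fits-determines : ∀ {col′ P′} F → All (Fits col P) F → All (Fits col′ P′) F → ∀ {x} → x ∈ psiList F →
                    col x ≡ col′ x × (∀ b → P b x ⇔ P′ b x)
  Fits-determines (node c m us ∷ ts) (fits e k φ ∷ φ′) (fits e′ k′ ψ ∷ ψ′) x∈ with ∈-word⁻ {c} us ts x∈
  ... | inj₁ p           = Fits-determines us φ ψ p
  ... | inj₂ (inj₁ refl) = trans e (sym e′) , λ b → mk⇔ (from (k′ b) ∘ to (k b)) (from (k b) ∘ to (k′ b))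
  ... | inj₂ (inj₂ p)    = Fits-determines ts φ′ ψ′ p

  Fits-cong : ∀ {col′ P′} F → (∀ {x} → x ∈ psiList F → col x ≡ col′ x × (∀ b → P b x ⇔ P′ b x)) →
              All (Fits col P) F → All (Fits col′ P′) F
  Fits-cong [] h [] = []
  Fits-cong (node c m us ∷ ts) h (fits e k φ ∷ φ′) with h (∈-word-root {c} us ts)
  ... | e′ , k′ = fits (trans (sym e′) e) (λ b → mk⇔ (to (k b) ∘ from (k′ b)) (to (k′ b) ∘ from (k b)))
                       (Fits-cong us (h ∘ ∈-word-sub {c} us ts) φ)
                ∷ Fits-cong ts (h ∘ ∈-word-rest {c} us ts) φ′

  roots-coloured : ∀ {c F} → Ordered c F → All (Fits col P) F → ∀ {x} → x ∈ roots F → col x ≡ c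
  roots-coloured (tree _ _ _ _) (fits e _ _ ∷ _)  (here refl) = e
  roots-coloured (tree _ _ _ o) (_ ∷ φ) (there q) = roots-coloured o φ q

  child-of : ∀ {c F} → Ordered c F → All (Fits col P) F → ∀ {a b} → a ∈ psiList F → P b a →
             b ∈ psiList F × col b ≡ opp (col a) × b <[ col b ] a
  child-of (tree {c} {m} {us} {ts} a b o o′) (fits e k φ ∷ φ′) x∈ p with ∈-word⁻ {c} us ts x∈
  ... | inj₁ q = let (r , s) = child-of o φ q p in ∈-word-sub {c} us ts r , s
  ... | inj₂ (inj₂ q) = let (r , s) = child-of o′ φ′ q p in ∈-word-rest {c} us ts r , s
  ... | inj₂ (inj₁ refl) = ∈-word-sub {c} us ts b∈ , cb , subst (λ c′ → _ <[ c′ ] _) (sym cb′)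
                             (<[]-flip c (All.lookup a b∈))
    where
    b∈ = ∈-roots⇒∈-word us (to (k _) p)
    cb′ = roots-coloured o φ (to (k _) p)
    cb = trans cb′ (cong opp (sym e))

  -- Two changes of colour give `b` the colour of `g`, and `g` precedes everything below it. For the
  -- tableau built from a forest, this is what forbids a left and an up arrow from blocking each
  -- other.
  grandchild-of : ∀ {c F} → Ordered c F → All (Fits col P) F → ∀ {a b g} → g ∈ psiList F →
                  P a g → P b a → g <[ col b ] b
  grandchild-of (tree {c} {m} {us} {ts} a b o o′) (fits e k φ ∷ φ′) x∈ p q with ∈-word⁻ {c} us ts x∈
  ... | inj₁ r = grandchild-of o φ r p q
  ... | inj₂ (inj₂ r) = grandchild-of o′ φ′ r p q
  ... | inj₂ (inj₁ refl) =
        let a∈ = ∈-roots⇒∈-word us (to (k _) p)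
            (b∈ , cb , _) = child-of o φ a∈ q
            (_ , ca , _) = child-of (tree a b o o′) (fits e k φ ∷ φ′) x∈ p
        in subst (λ c′ → _ <[ c′ ] _)
             (sym (trans cb (trans (cong opp ca) (trans (opp-involutive _) e)))) (All.lookup a b∈)

-- Statistics of the word of a forest

-- Each letter precedes its successor in the order of its own colour, so white letters are ascents
-- and black ones descents. The final letter must be white because the last letter counts as an
-- ascent.
data Steps (col : ℕ → Color) : List ℕ → Set where
  []   : Steps col []
  last : ∀ {x} → col x ≡ white → Steps col (x ∷ [])
  step : ∀ {x y w} → x <[ col x ] y → Steps col (y ∷ w) → Steps col (x ∷ y ∷ w)

-- What may follow the word `xs` of a forest of colour `c`: nothing, at the outermost white level
-- only, or a letter beyond all of `xs` in the order of `c`. For a list of siblings that letter is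
-- their parent.
data Bound : Color → List ℕ → List ℕ → Set where
  end  : ∀ {xs} → Bound white xs []
  next : ∀ {c xs y r} → All (_<[ c ] y) xs → Bound c xs (y ∷ r)

module _ {col : ℕ → Color} where

  -- The letter after a root belongs to the trees of its right siblings, all of whose letters it
  -- precedes, or, if there are none, is the first letter of `r`, controlled by `Bound`. The
  -- subtrees are followed by their root, which lies beyond them in the opposite order.
  Steps-word : ∀ {P c F r} → Ordered c F → All (Fits col P) F → Bound c (psiList F) r →
               Steps col r → Steps col (psiList F ++ r)
  Steps-word [] _ _ s = s
  Steps-word {c = c} {r = r} (tree {m = m} {us} {ts} a b o o′) (fits {c = .c} e k φ ∷ φ′) bd s =
    subst (Steps col) (sym reassoc)
      (Steps-word o φ (next (All.map (<[]-flip c) a)) (root-step b bd (Steps-word o′ φ′ (bound-rest bd) s)))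
    where
    reassoc : psiList (node c m us ∷ ts) ++ r ≡ psiList us ++ m ∷ (psiList ts ++ r)
    reassoc = trans (cong (_++ r) (psiList-∷ {c} us ts)) (++-assoc (psiList us) (m ∷ psiList ts) r)
    bound-rest : ∀ {r} → Bound c (psiList (node c m us ∷ ts)) r → Bound c (psiList ts) r
    bound-rest end      = end
    bound-rest (next q) = next (Allₚ.++⁻ʳ (psiList us ++ m ∷ []) q)
    root-step : ∀ {w r} → All (m <[ c ]_) w → Bound c (psiList (node c m us ∷ ts)) r →
                Steps col (w ++ r) → Steps col (m ∷ (w ++ r))
    root-step (p ∷ _) bd s = step (subst (λ c → m <[ c ] _) (sym e) p) s
    root-step [] end s = last e
    root-step [] (next q) s = step (subst (λ c → m <[ c ] _) (sym e) (All.lookup q (∈-word-root {c} us ts))) s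

  Steps-suffix : ∀ u {v} → Steps col (u ++ v) → Steps col v
  Steps-suffix []           s          = s
  Steps-suffix (x ∷ [])     (last _)   = []
  Steps-suffix (x ∷ [])     (step _ s) = s
  Steps-suffix (x ∷ y ∷ u)  (step _ s) = Steps-suffix (y ∷ u) s

  Steps-at : ∀ {σ x} → Steps col σ → x ∈ σ →
             (col x ≡ white → Ascent x σ) × (col x ≡ black → Descent x σ)
  Steps-at {σ} s x∈ with ∈-∃++ x∈
  ... | u , v , refl = (λ e → asc e v (Steps-suffix u s)) , λ e → desc e v (Steps-suffix u s)
    where
    asc : ∀ {x} → col x ≡ white → ∀ v → Steps col (x ∷ v) → Ascent x (u ++ x ∷ v)
    asc e []      _ = inj₁ (u , refl)
    asc {x} e (y ∷ v) (step p _) = inj₂ (u , y , v , refl , subst (λ c → x <[ c ] y) e p)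
    desc : ∀ {x} → col x ≡ black → ∀ v → Steps col (x ∷ v) → Descent x (u ++ x ∷ v)
    desc e []      (last e′) with () ← trans (sym e) e′
    desc {x} e (y ∷ v) (step p _) = u , y , v , refl , subst (λ c → x <[ c ] y) e p

  ascent⇒white : ∀ {σ x} → Steps col σ → Ascent x σ → col x ≡ white
  ascent⇒white s (inj₁ (u , refl)) with Steps-suffix u s
  ... | last e = e
  ascent⇒white {x = x} s (inj₂ (u , y , v , refl , x<y)) with Steps-suffix u s
  ... | step p _ with col x
  ...   | white = refl
  ...   | black = ⊥-elim (<-asym x<y p)

  descent⇒black : ∀ {σ x} → Steps col σ → Descent x σ → col x ≡ black
  descent⇒black {x = x} s (u , y , v , refl , y<x) with Steps-suffix u s
  ... | step p _ with col x
  ...   | black = refl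
  ...   | white = ⊥-elim (<-asym y<x p)

root⇒extremal : ∀ {c F x} → Ordered c F → x ∈ roots F →
                ∃ λ u → ∃ λ v → psiList F ≡ u ++ x ∷ v × All (x <[ c ]_) v
root⇒extremal (tree {c} {m} {us} {ts} a b _ _) (here refl) =
  psiList us , psiList ts , psiList-∷ {c} us ts , b
root⇒extremal {c} (tree {m = m} {us} {ts} a b _ o) (there p) with root⇒extremal o p
... | u , v , e , q = (psiList us ++ m ∷ []) ++ u , v ,
      trans (cong ((psiList us ++ m ∷ []) ++_) e) (sym (++-assoc (psiList us ++ m ∷ []) u _)) , q

-- A letter strictly inside a tree has the root of that tree on its right, and the root precedes it
-- in the order of `c`.
extremal⇒root : ∀ {c F x u v} → Ordered c F → psiList F ≡ u ++ x ∷ v → All (x <[ c ]_) v → x ∈ roots F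
extremal⇒root {u = []}    [] ()
extremal⇒root {u = _ ∷ _} [] ()
extremal⇒root {c} {x = x} (tree {m = m} {us} {ts} a b _ o) e q
  with locate (psiList us) (trans (sym (psiList-∷ {c} us ts)) e)
... | inj₁ (v′ , e′ , refl) =
      ⊥-elim (<[]-asym c (All.lookup a (subst (x ∈_) (sym e′) (∈-insert _)))
                         (All.lookup q (∈-++⁺ʳ v′ (here refl))))
... | inj₂ ([] , refl , refl) = here refl
... | inj₂ (_ ∷ u′ , refl , e′) = there (extremal⇒root {u = u′} o (∷-injectiveʳ e′) q)

-- Sorting

insC : Color → PTree → List PTree → List PTree
insC white = insInc
insC black = insDec

sortC : Color → List PTree → List PTree
sortC white = sortInc
sortC black = sortDec

insC-cases : ∀ c t u us →
  (insC c t (u ∷ us) ≡ t ∷ u ∷ us × rootLabel t <[ c ] rootLabel u) ⊎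
  (insC c t (u ∷ us) ≡ u ∷ insC c t us × ¬ (rootLabel t <[ c ] rootLabel u))
insC-cases white t u us with rootLabel t <ᵇ rootLabel u in eq
... | true  = inj₁ (refl , <ᵇ⇒< _ _ (from T-≡ eq))
... | false = inj₂ (refl , λ p → subst T eq (<⇒<ᵇ p))
insC-cases black t u us with rootLabel u <ᵇ rootLabel t in eq
... | true  = inj₁ (refl , <ᵇ⇒< _ _ (from T-≡ eq))
... | false = inj₂ (refl , λ p → subst T eq (<⇒<ᵇ p))

insC-↭ : ∀ c t us → insC c t us ↭ t ∷ us
insC-↭ white t [] = ↭-refl
insC-↭ black t [] = ↭-refl
insC-↭ c t (u ∷ us) with insC-cases c t u us
... | inj₁ (e , _) rewrite e = ↭-refl
... | inj₂ (e , _) rewrite e = ↭-trans (prep u (insC-↭ c t us)) (swap u t ↭-refl)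

sortC-∷ : ∀ c t ts → sortC c (t ∷ ts) ≡ insC c t (sortC c ts)
sortC-∷ white t ts = refl
sortC-∷ black t ts = refl

sortC-↭ : ∀ c ts → sortC c ts ↭ ts
sortC-↭ white [] = ↭-refl
sortC-↭ black [] = ↭-refl
sortC-↭ c (t ∷ ts) rewrite sortC-∷ c t ts = ↭-trans (insC-↭ c t (sortC c ts)) (prep t (sortC-↭ c ts))

psiList-↭ : ∀ {ts us} → ts ↭ us → psiList ts ↭ psiList us
psiList-↭ Perm.refl = ↭-refl
psiList-↭ (prep t p) = Permₚ.++⁺ˡ (psi t) (psiList-↭ p)
psiList-↭ (swap t u p) = ↭-trans (Permₚ.shifts (psi t) (psi u)) (Permₚ.++⁺ˡ (psi u) (Permₚ.++⁺ˡ (psi t) (psiList-↭ p)))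
psiList-↭ (Perm.trans p q) = ↭-trans (psiList-↭ p) (psiList-↭ q)

Unique-↭ : ∀ {A : Set} {xs ys : List A} → xs ↭ ys → Unique xs → Unique ys
Unique-↭ {A} p = SetoidPerm.Unique-resp-↭ (setoid A) (Perm.↭⇒↭ₛ p)

-- Insertion compares only roots, whereas `Ordered` speaks of all later letters. The two match
-- because a root precedes its whole tree, so a comparison of roots extends to the letters by
-- transitivity.
insC-Ordered : ∀ c t us → Ordered c (t ∷ []) → Ordered c us → rootLabel t ∉ roots us →
               Ordered c (insC c t us)
insC-Ordered white t [] o _ _ = o
insC-Ordered black t [] o _ _ = o
insC-Ordered c t@(node .c m ws) (u@(node .c m′ vs) ∷ us) (tree a _ o _) (tree a′ b′ p p′) t∉
  with insC-cases c t u us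
... | inj₁ (e , m<m′) rewrite e =
      tree a (subst (All (m <[ c ]_)) (sym (psiList-∷ {c} vs us))
               (Allₚ.++⁺ (All.map (<[]-trans c m<m′) a′) (m<m′ ∷ All.map (<[]-trans c m<m′) b′)))
           o (tree a′ b′ p p′)
... | inj₂ (e , m≮m′) rewrite e =
      tree a′ (Permₚ.All-resp-↭ (↭-sym (psiList-↭ (insC-↭ c t us)))
                (subst (All (m′ <[ c ]_)) (sym (psiList-∷ {c} ws us))
                  (Allₚ.++⁺ (All.map (<[]-trans c m′<m) a) (m′<m ∷ b′))))
           p (insC-Ordered c t us (tree a [] o []) p′ (t∉ ∘ there))
  where
  m′<m : m′ <[ c ] m
  m′<m with <[]-connex c (t∉ ∘ here)
  ... | inj₁ q = ⊥-elim (m≮m′ q)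
  ... | inj₂ q = q

sortC-Ordered : ∀ c ts → All (λ t → Ordered c (t ∷ [])) ts → Unique (roots ts) → Ordered c (sortC c ts)
sortC-Ordered white [] _ _ = []
sortC-Ordered black [] _ _ = []
sortC-Ordered c (t ∷ ts) (o ∷ os) (t∉ ∷ u) rewrite sortC-∷ c t ts =
  insC-Ordered c t (sortC c ts) o (sortC-Ordered c ts os u)
    (λ t∈ → All.lookup t∉ (Permₚ.∈-resp-↭ (Permₚ.map⁺ rootLabel (sortC-↭ c ts)) t∈) refl)

-- Boolean list functions

T-not : ∀ {b} → T (not b) ⇔ (¬ T b)
T-not {true}  = mk⇔ (λ ()) (λ f → f _)
T-not {false} = mk⇔ (λ _ ()) (λ _ → _)

T-any : ∀ {A : Set} {p : A → Bool} {xs} → T (any p xs) ⇔ (∃ λ x → x ∈ xs × T (p x))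
T-any = mk⇔ (find ∘ from any⇔) (λ (x , x∈ , px) → to any⇔ (lose x∈ px))

T-mem : ∀ {x xs} → T (mem x xs) ⇔ x ∈ xs
T-mem {x} {xs} = mk⇔ (λ t → let (y , y∈ , e) = to T-any t in subst (_∈ xs) (sym (≡ᵇ⇒≡ x y e)) y∈)
                     (λ x∈ → from T-any (x , x∈ , ≡⇒≡ᵇ x x refl))

module _ {A : Set} {p : A → Bool} where

  ∈-filterᵇ : ∀ {x} xs → x ∈ filterᵇ p xs ⇔ (x ∈ xs × T (p x))
  ∈-filterᵇ xs = mk⇔ (λ x∈ → ⊆ xs x∈ , holds xs x∈) (λ (x∈ , px) → keep xs x∈ px)
    where
    ⊆ : ∀ {x} xs → x ∈ filterᵇ p xs → x ∈ xs
    ⊆ (y ∷ xs) x∈ with p y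
    ⊆ (y ∷ xs) (here e)   | true  = here e
    ⊆ (y ∷ xs) (there x∈) | true  = there (⊆ xs x∈)
    ⊆ (y ∷ xs) x∈         | false = there (⊆ xs x∈)
    holds : ∀ {x} xs → x ∈ filterᵇ p xs → T (p x)
    holds (y ∷ xs) x∈ with p y in eq
    holds (y ∷ xs) (here refl) | true  = from T-≡ eq
    holds (y ∷ xs) (there x∈)  | true  = holds xs x∈
    holds (y ∷ xs) x∈          | false = holds xs x∈
    keep : ∀ {x} xs → x ∈ xs → T (p x) → x ∈ filterᵇ p xs
    keep (y ∷ xs) x∈ px with p y in eq
    keep (y ∷ xs) (here e)    px | true  = here e
    keep (y ∷ xs) (there x∈)  px | true  = there (keep xs x∈ px)
    keep (y ∷ xs) (here refl) px | false = ⊥-elim (subst T eq px)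
    keep (y ∷ xs) (there x∈)  px | false = keep xs x∈ px

  filterᵇ-all : ∀ xs → (∀ {x} → x ∈ xs → T (p x)) → filterᵇ p xs ≡ xs
  filterᵇ-all [] h = refl
  filterᵇ-all (x ∷ xs) h rewrite to T-≡ (h (here refl)) = cong (x ∷_) (filterᵇ-all xs (h ∘ there))

  filterᵇ-Unique : ∀ {xs} → Unique xs → Unique (filterᵇ p xs)
  filterᵇ-Unique [] = []
  filterᵇ-Unique {x ∷ xs} (x∉ ∷ u) with p x
  ... | true  = All.tabulate (λ y∈ → All.lookup x∉ (proj₁ (to (∈-filterᵇ xs) y∈))) ∷ filterᵇ-Unique u
  ... | false = filterᵇ-Unique u

  length-filterᵇ : ∀ xs → length (filterᵇ p xs) ≤ length xs
  length-filterᵇ [] = z≤n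
  length-filterᵇ (x ∷ xs) with p x
  ... | true  = s≤s (length-filterᵇ xs)
  ... | false = m≤n⇒m≤1+n (length-filterᵇ xs)

module _ {A : Set} {p q : A → Bool} where

  filterᵇ-cong : ∀ xs → (∀ {x} → x ∈ xs → T (p x) ⇔ T (q x)) → filterᵇ p xs ≡ filterᵇ q xs
  filterᵇ-cong [] h = refl
  filterᵇ-cong (x ∷ xs) h with p x | q x | h (here refl)
  ... | true  | true  | _ = cong (x ∷_) (filterᵇ-cong xs (h ∘ there))
  ... | false | false | _ = filterᵇ-cong xs (h ∘ there)
  ... | true  | false | e = ⊥-elim (to e _)
  ... | false | true  | e = ⊥-elim (from e _)

  length-filterᵇ-mono : ∀ xs → (∀ {x} → T (p x) → T (q x)) → length (filterᵇ p xs) ≤ length (filterᵇ q xs)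
  length-filterᵇ-mono [] h = z≤n
  length-filterᵇ-mono (x ∷ xs) h with p x | q x | h {x}
  ... | true  | true  | _ = s≤s (length-filterᵇ-mono xs h)
  ... | false | false | _ = length-filterᵇ-mono xs h
  ... | false | true  | _ = m≤n⇒m≤1+n (length-filterᵇ-mono xs h)
  ... | true  | false | e = ⊥-elim (e _)

  length-filterᵇ-strict : ∀ {x} xs → (∀ {x} → T (p x) → T (q x)) → x ∈ xs → T (q x) → ¬ T (p x) →
                          length (filterᵇ p xs) < length (filterᵇ q xs)
  length-filterᵇ-strict (x ∷ xs) h (here refl) qx ¬px with p x | q x
  ... | true  | _    = ⊥-elim (¬px _)
  ... | false | true = s≤s (length-filterᵇ-mono xs h)
  length-filterᵇ-strict (x ∷ xs) h (there x∈) qx ¬px with p x | q x | h {x}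
  ... | true  | true  | _ = s≤s (length-filterᵇ-strict xs h x∈ qx ¬px)
  ... | false | false | _ = length-filterᵇ-strict xs h x∈ qx ¬px
  ... | false | true  | _ = m≤n⇒m≤1+n (length-filterᵇ-strict xs h x∈ qx ¬px)
  ... | true  | false | e = ⊥-elim (e _)

∈⇒0<length : ∀ {A : Set} {x : A} {xs} → x ∈ xs → 0 < length xs
∈⇒0<length (here _)  = z<s
∈⇒0<length (there _) = z<s

Unique-singleton : ∀ {A : Set} {k : A} {xs} → Unique xs → k ∈ xs → (∀ {x} → x ∈ xs → x ≡ k) → xs ≡ k ∷ []
Unique-singleton {xs = x ∷ []} u k∈ h = cong (_∷ []) (h (here refl))
Unique-singleton {xs = x ∷ y ∷ xs} (x∉ ∷ _) k∈ h =
  ⊥-elim (All.lookup x∉ (here refl) (trans (h (here refl)) (sym (h (there (here refl))))))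

minL-just : ∀ {x xs} → x ∈ xs → ∃ λ m → minL xs ≡ just m × m ∈ xs × (∀ {y} → y ∈ xs → m ≤ y)
minL-just {xs = x ∷ []} _ = x , refl , here refl , λ { (here refl) → ≤-refl }
minL-just {xs = x ∷ xs@(_ ∷ _)} _ with minL xs | minL-just {xs = xs} (here refl)
... | _ | m , refl , m∈ , m≤ with x <ᵇ m in eq
...   | true  = x , refl , here refl , λ
        { (here refl) → ≤-refl ; (there y∈) → ≤-trans (<⇒≤ (<ᵇ⇒< x m (from T-≡ eq))) (m≤ y∈) }
...   | false = m , refl , there m∈ , λ
        { (here refl) → ≮⇒≥ (λ x<m → subst T eq (<⇒<ᵇ x<m)) ; (there y∈) → m≤ y∈ }

maxL-just : ∀ {x xs} → x ∈ xs → ∃ λ m → maxL xs ≡ just m × m ∈ xs × (∀ {y} → y ∈ xs → y ≤ m)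
maxL-just {xs = x ∷ []} _ = x , refl , here refl , λ { (here refl) → ≤-refl }
maxL-just {xs = x ∷ xs@(_ ∷ _)} _ with maxL xs | maxL-just {xs = xs} (here refl)
... | _ | m , refl , m∈ , m≤ with m <ᵇ x in eq
...   | true  = x , refl , here refl , λ
        { (here refl) → ≤-refl ; (there y∈) → ≤-trans (m≤ y∈) (<⇒≤ (<ᵇ⇒< m x (from T-≡ eq))) }
...   | false = m , refl , there m∈ , λ
        { (here refl) → ≮⇒≥ (λ m<x → subst T eq (<⇒<ᵇ m<x)) ; (there y∈) → m≤ y∈ }

minL-unique : ∀ {x xs} → x ∈ xs → (∀ {y} → y ∈ xs → x ≤ y) → minL xs ≡ just x
minL-unique x∈ x≤ with minL-just x∈
... | m , e , m∈ , m≤ = trans e (cong just (≤-antisym (m≤ x∈) (x≤ m∈)))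

maxL-unique : ∀ {x xs} → x ∈ xs → (∀ {y} → y ∈ xs → y ≤ x) → maxL xs ≡ just x
maxL-unique x∈ ≤x with maxL-just x∈
... | m , e , m∈ , ≤m = trans e (cong just (≤-antisym (≤x m∈) (≤m x∈)))

-- Components and trees of the inherited tableaux

module Inherited
  (L₀ : List ℕ) (row : ℕ → Bool) (arr : ℕ → ℕ → Arrow)
  (left-emp : ∀ {i j j′} → i ∈ L₀ → j ∈ L₀ → j′ ∈ L₀ → arr i j ≡ left → j < j′ → arr i j′ ≡ emp)
  (up-emp : ∀ {i i′ j} → i ∈ L₀ → i′ ∈ L₀ → j ∈ L₀ → arr i j ≡ up → i′ < i → arr i′ j ≡ emp)
  where

  colour : ℕ → Color
  colour x = if row x then white else black

  Cell : ℕ → ℕ → Set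
  Cell i j = row i ≡ true × row j ≡ false × i < j

  Parent : ℕ → ℕ → Set
  Parent b a = b ∈ L₀ × a ∈ L₀ × ((Cell b a × arr b a ≡ left) ⊎ (Cell a b × arr a b ≡ up))

  Parent-functional : ∀ {b a a′} → Parent b a → Parent b a′ → a ≡ a′
  Parent-functional {b} {a} {a′} (b∈ , a∈ , inj₁ ((r , c , _) , e)) (_ , a′∈ , inj₁ ((r′ , c′ , _) , e′))
    with <-cmp a a′
  ... | tri≈ _ p _ = p
  ... | tri< p _ _ with () ← trans (sym e′) (left-emp b∈ a∈ a′∈ e p)
  ... | tri> _ _ p with () ← trans (sym e) (left-emp b∈ a′∈ a∈ e′ p)
  Parent-functional {b} {a} {a′} (b∈ , a∈ , inj₂ ((r , c , _) , e)) (_ , a′∈ , inj₂ ((r′ , c′ , _) , e′))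
    with <-cmp a a′
  ... | tri≈ _ p _ = p
  ... | tri> _ _ p with () ← trans (sym e′) (up-emp a∈ a′∈ b∈ e p)
  ... | tri< p _ _ with () ← trans (sym e) (up-emp a′∈ a∈ b∈ e′ p)
  Parent-functional (_ , _ , inj₁ ((r , _) , _)) (_ , _ , inj₂ ((_ , c , _) , _)) with () ← trans (sym r) c
  Parent-functional (_ , _ , inj₂ ((_ , c , _) , _)) (_ , _ , inj₁ ((r , _) , _)) with () ← trans (sym r) c

  Parent-colour : ∀ {b a} → Parent b a → colour b ≡ opp (colour a)
  Parent-colour (_ , _ , inj₁ ((r , c , _) , _)) rewrite r | c = refl
  Parent-colour (_ , _ , inj₂ ((r , c , _) , _)) rewrite r | c = refl

  Parent-≺ : ∀ {b a} → Parent b a → a <[ colour a ] b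
  Parent-≺ (_ , _ , inj₁ ((r , c , p) , _)) rewrite c = p
  Parent-≺ (_ , _ , inj₂ ((r , c , p) , _)) rewrite r = p

  -- Let row `b` have its left arrow in column `a`, whose up arrow is in row `g`. If `g` were below
  -- `b`, the left arrow would sit above that up arrow, in a cell that has to be empty; if `g` were
  -- `b`, one cell would hold both arrows. The case of columns is the mirror image.
  grandparent-≺ : ∀ {b a g} → Parent b a → Parent a g → g <[ colour b ] b
  grandparent-≺ {b} {a} {g} (b∈ , a∈ , inj₁ ((r , c , _) , e)) (_ , g∈ , inj₂ (_ , e′)) rewrite r with <-cmp g b
  ... | tri< p _ _ = p
  ... | tri≈ _ refl _ with () ← trans (sym e) e′
  ... | tri> _ _ p with () ← trans (sym e) (up-emp g∈ b∈ a∈ e′ p)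
  grandparent-≺ {b} {a} {g} (b∈ , a∈ , inj₂ ((r , c , _) , e)) (_ , g∈ , inj₁ (_ , e′)) rewrite c with <-cmp b g
  ... | tri< p _ _ = p
  ... | tri≈ _ refl _ with () ← trans (sym e) e′
  ... | tri> _ _ p with () ← trans (sym e) (left-emp a∈ g∈ b∈ e′ p)
  grandparent-≺ (_ , _ , inj₁ ((_ , c , _) , _)) (_ , _ , inj₁ ((r , _) , _)) with () ← trans (sym r) c
  grandparent-≺ (_ , _ , inj₂ ((r , _) , _)) (_ , _ , inj₂ ((_ , c , _) , _)) with () ← trans (sym r) c

  -- Descendants and roots

  data Desc (k : ℕ) : ℕ → Set where
    self  : Desc k k
    child : ∀ {a b} → Desc k a → Parent b a → Desc k b

  -- A single step respects the order of the parent's colour, which is that of `k` only on every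
  -- second level. If the parent of `b` has the colour of `k`, this step suffices; otherwise `b` has
  -- that colour itself and is compared with its grandparent.
  Desc-≺ : ∀ {k x} → Desc k x → x ≡ k ⊎ k <[ colour k ] x
  Desc-≺ self = inj₁ refl
  Desc-≺ (child self p) = inj₂ (Parent-≺ p)
  Desc-≺ {k} (child {a} {b} d′@(child {g} d q) p) = inj₂ (by-colour (Desc-≺ d′) (Desc-≺ d) (colour-dec (colour k) (colour a)))
    where
    colour-dec : ∀ c c′ → c′ ≡ c ⊎ opp c′ ≡ c
    colour-dec white white = inj₁ refl
    colour-dec white black = inj₂ refl
    colour-dec black white = inj₂ refl
    colour-dec black black = inj₁ refl
    ≼-≺ : ∀ {y z} → y ≡ k ⊎ k <[ colour k ] y → y <[ colour k ] z → k <[ colour k ] z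
    ≼-≺ (inj₁ refl) q = q
    ≼-≺ (inj₂ r)    q = <[]-trans (colour k) r q
    by-colour : a ≡ k ⊎ k <[ colour k ] a → g ≡ k ⊎ k <[ colour k ] g →
                colour a ≡ colour k ⊎ opp (colour a) ≡ colour k → k <[ colour k ] b
    by-colour ka kg (inj₁ e) = ≼-≺ ka (subst (λ c → a <[ c ] b) e (Parent-≺ p))
    by-colour ka kg (inj₂ e) = ≼-≺ kg
      (subst (λ c → g <[ c ] b) (trans (Parent-colour p) e) (grandparent-≺ p q))

  -- Splitting and cutting change only the label list. Row markers and arrows stay those of the
  -- ambient tableau, so one parent relation serves all the tableaux met in the recursion.
  tab : List ℕ → LT
  tab L = lt L row arr

  -- Closure under children but not under parents: this survives cutting off a root, after which its
  -- children are the roots of what is left.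
  record Closed (L : List ℕ) : Set where
    field
      ⊆L₀    : ∀ {x} → x ∈ L → x ∈ L₀
      unique : Unique L
      down   : ∀ {b a} → Parent b a → a ∈ L → b ∈ L
  open Closed

  RootOf : List ℕ → ℕ → Set
  RootOf L k = k ∈ L × (∀ {a} → a ∈ L → ¬ Parent k a)

  Desc-closed : ∀ {L} → Closed L → ∀ {k x} → k ∈ L → Desc k x → x ∈ L
  Desc-closed C k∈ self        = k∈
  Desc-closed C k∈ (child d p) = down C p (Desc-closed C k∈ d)

  root-unique : ∀ {L} → Closed L → ∀ {k k′ x} → RootOf L k → RootOf L k′ → Desc k x → Desc k′ x → k ≡ k′
  root-unique C r r′ self self = refl
  root-unique C r r′ self (child d p) = ⊥-elim (proj₂ r (Desc-closed C (proj₁ r′) d) p)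
  root-unique C r r′ (child d p) self = ⊥-elim (proj₂ r′ (Desc-closed C (proj₁ r) d) p)
  root-unique C r r′ (child d p) (child d′ p′) with Parent-functional p p′
  ... | refl = root-unique C r r′ d d′

  -- Arrows and free labels of an inherited tableau

  module _ {L : List ℕ} where

    private
      inside : ℕ → ℕ → Bool
      inside i j = mem i L ∧ mem j L ∧ row i ∧ not (row j) ∧ (i <ᵇ j)

      T-inside : ∀ {i j} → T (inside i j) ⇔ (i ∈ L × j ∈ L × Cell i j)
      T-inside {i} {j} = mk⇔
        (λ t → let (a , t₁) = to T-∧ t ; (b , t₂) = to (T-∧ {mem j L}) t₁
                   (c , t₃) = to (T-∧ {row i}) t₂ ; (d , e) = to (T-∧ {not (row j)}) t₃
               in to T-mem a , to T-mem b , to T-≡ c , to T-not-≡ d , <ᵇ⇒< i j e)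
        (λ (a , b , c , d , e) → from T-∧ (from T-mem a , from (T-∧ {mem j L}) (from T-mem b ,
           from (T-∧ {row i}) (from T-≡ c , from (T-∧ {not (row j)}) (from T-not-≡ d , <⇒<ᵇ e)))))

    arrowAt-inside : ∀ {i j} → i ∈ L → j ∈ L → Cell i j → arrowAt (tab L) i j ≡ arr i j
    arrowAt-inside {i} {j} i∈ j∈ c rewrite to T-≡ (from (T-inside {i} {j}) (i∈ , j∈ , c)) = refl

    arrowAt-cases : ∀ i j → arrowAt (tab L) i j ≡ emp ⊎
                    (arrowAt (tab L) i j ≡ arr i j × i ∈ L × j ∈ L × Cell i j)
    arrowAt-cases i j with inside i j in eq
    ... | true  = inj₂ (refl , to T-inside (from T-≡ eq))
    ... | false = inj₁ refl

  module _ {L : List ℕ} (C : Closed L) where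

    T-hasArrow : ∀ {a b} → T (hasArrow (tab L) a b) ⇔
                 (a ∈ L × b ∈ L × Cell a b × (arr a b ≡ left ⊎ arr a b ≡ up))
    T-hasArrow {a} {b} = mk⇔ f g
      where
      f : T (hasArrow (tab L) a b) → a ∈ L × b ∈ L × Cell a b × (arr a b ≡ left ⊎ arr a b ≡ up)
      f t with arrowAt-cases {L} a b
      ... | inj₁ e = ⊥-elim (subst (T ∘ not ∘ isEmp) e t)
      ... | inj₂ (e , a∈ , b∈ , c) with arr a b | subst (T ∘ not ∘ isEmp) e t
      ...   | left | _ = a∈ , b∈ , c , inj₁ refl
      ...   | up   | _ = a∈ , b∈ , c , inj₂ refl
      g : a ∈ L × b ∈ L × Cell a b × (arr a b ≡ left ⊎ arr a b ≡ up) → T (hasArrow (tab L) a b)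
      g (a∈ , b∈ , c , inj₁ e) = subst (T ∘ not ∘ isEmp) (sym (trans (arrowAt-inside a∈ b∈ c) e)) _
      g (a∈ , b∈ , c , inj₂ e) = subst (T ∘ not ∘ isEmp) (sym (trans (arrowAt-inside a∈ b∈ c) e)) _

    T-adj : ∀ {a b} → T (adj (tab L) a b) ⇔ (a ∈ L × b ∈ L × (Parent a b ⊎ Parent b a))
    T-adj {a} {b} = mk⇔ (λ t → f (to (T-∨ {hasArrow (tab L) a b}) t)) (from (T-∨ {hasArrow (tab L) a b}) ∘ g)
      where
      f : T (hasArrow (tab L) a b) ⊎ T (hasArrow (tab L) b a) → a ∈ L × b ∈ L × (Parent a b ⊎ Parent b a)
      f (inj₁ t) with to T-hasArrow t
      ... | a∈ , b∈ , c , inj₁ e = a∈ , b∈ , inj₁ (⊆L₀ C a∈ , ⊆L₀ C b∈ , inj₁ (c , e))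
      ... | a∈ , b∈ , c , inj₂ e = a∈ , b∈ , inj₂ (⊆L₀ C b∈ , ⊆L₀ C a∈ , inj₂ (c , e))
      f (inj₂ t) with to T-hasArrow t
      ... | b∈ , a∈ , c , inj₁ e = a∈ , b∈ , inj₂ (⊆L₀ C b∈ , ⊆L₀ C a∈ , inj₁ (c , e))
      ... | b∈ , a∈ , c , inj₂ e = a∈ , b∈ , inj₁ (⊆L₀ C a∈ , ⊆L₀ C b∈ , inj₂ (c , e))
      g : a ∈ L × b ∈ L × (Parent a b ⊎ Parent b a) → T (hasArrow (tab L) a b) ⊎ T (hasArrow (tab L) b a)
      g (a∈ , b∈ , inj₁ (_ , _ , inj₁ (c , e))) = inj₁ (from T-hasArrow (a∈ , b∈ , c , inj₁ e))
      g (a∈ , b∈ , inj₁ (_ , _ , inj₂ (c , e))) = inj₂ (from T-hasArrow (b∈ , a∈ , c , inj₂ e))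
      g (a∈ , b∈ , inj₂ (_ , _ , inj₁ (c , e))) = inj₂ (from T-hasArrow (b∈ , a∈ , c , inj₁ e))
      g (a∈ , b∈ , inj₂ (_ , _ , inj₂ (c , e))) = inj₁ (from T-hasArrow (a∈ , b∈ , c , inj₂ e))

    -- The boolean `isFree` decides being a root: the arrow that makes a label not free is the arrow
    -- to its parent, and it lies in a cell of `L`.
    free-or-parent : ∀ {k} → k ∈ L →
      (T (isFree (tab L) k) × RootOf L k) ⊎ (¬ T (isFree (tab L) k) × ∃ λ a → a ∈ L × Parent k a)
    free-or-parent {k} k∈ = by-row (row k) refl
      where
      hasLeft hasUp : Bool
      hasLeft = any (λ j → isLeft (arrowAt (tab L) k j)) L
      hasUp   = any (λ i → isUp (arrowAt (tab L) i k)) L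
      isFree≡ : ∀ {b} → row k ≡ b → isFree (tab L) k ≡ (if b then not hasLeft else not hasUp)
      isFree≡ = cong (λ b → if b then not hasLeft else not hasUp)
      left-parent : T hasLeft → ∃ λ a → a ∈ L × Parent k a
      left-parent t with to T-any t
      ... | j , j∈ , l with arrowAt-cases {L} k j
      ...   | inj₁ e = ⊥-elim (subst (T ∘ isLeft) e l)
      ...   | inj₂ (e , _ , _ , c) with arr k j in eq | subst (T ∘ isLeft) e l
      ...     | left | _ = j , j∈ , ⊆L₀ C k∈ , ⊆L₀ C j∈ , inj₁ (c , eq)
      up-parent : T hasUp → ∃ λ a → a ∈ L × Parent k a
      up-parent t with to T-any t
      ... | i , i∈ , l with arrowAt-cases {L} i k
      ...   | inj₁ e = ⊥-elim (subst (T ∘ isUp) e l)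
      ...   | inj₂ (e , _ , _ , c) with arr i k in eq | subst (T ∘ isUp) e l
      ...     | up | _ = i , i∈ , ⊆L₀ C k∈ , ⊆L₀ C i∈ , inj₂ (c , eq)
      by-row : ∀ b → row k ≡ b →
        (T (isFree (tab L) k) × RootOf L k) ⊎ (¬ T (isFree (tab L) k) × ∃ λ a → a ∈ L × Parent k a)
      by-row true rk with T? hasLeft
      ... | yes t = inj₂ ((λ f → to T-not (subst T (isFree≡ rk) f) t) , left-parent t)
      ... | no ¬t = inj₁ (subst T (sym (isFree≡ rk)) (from T-not ¬t) , k∈ , no-parent)
        where
        no-parent : ∀ {a} → a ∈ L → ¬ Parent k a
        no-parent {a} a∈ (_ , _ , inj₁ (c , e)) =
          ¬t (from T-any (a , a∈ , subst (T ∘ isLeft) (sym (trans (arrowAt-inside k∈ a∈ c) e)) _))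
        no-parent a∈ (_ , _ , inj₂ ((_ , c , _) , _)) with () ← trans (sym rk) c
      by-row false rk with T? hasUp
      ... | yes t = inj₂ ((λ f → to T-not (subst T (isFree≡ rk) f) t) , up-parent t)
      ... | no ¬t = inj₁ (subst T (sym (isFree≡ rk)) (from T-not ¬t) , k∈ , no-parent)
        where
        no-parent : ∀ {a} → a ∈ L → ¬ Parent k a
        no-parent {a} a∈ (_ , _ , inj₂ (c , e)) =
          ¬t (from T-any (a , a∈ , subst (T ∘ isUp) (sym (trans (arrowAt-inside a∈ k∈ c) e)) _))
        no-parent a∈ (_ , _ , inj₁ ((r , _) , _)) with () ← trans (sym rk) r

    ∈-Free : ∀ {k} → k ∈ Free (tab L) ⇔ RootOf L k
    ∈-Free {k} = mk⇔
      (λ k∈F → let (k∈ , f) = to (∈-filterᵇ L) k∈F in root k∈ f)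
      (λ r → from (∈-filterᵇ L) (proj₁ r , free r))
      where
      root : k ∈ L → T (isFree (tab L) k) → RootOf L k
      root k∈ f with free-or-parent k∈
      ... | inj₁ (_ , r)  = r
      ... | inj₂ (¬f , _) = ⊥-elim (¬f f)
      free : RootOf L k → T (isFree (tab L) k)
      free (k∈ , h) with free-or-parent k∈
      ... | inj₁ (f , _) = f
      ... | inj₂ (_ , a , a∈ , p) = ⊥-elim (h a∈ p)

    -- Going to the grandparent decreases a row, so the search for the root of
    -- a row ends.
    private
      row-root : ∀ n {x} → x < n → x ∈ L → colour x ≡ white → ∃ λ k → RootOf L k × Desc k x
      row-root (suc n) {x} (s≤s x≤n) x∈ cx with free-or-parent x∈
      ... | inj₁ (_ , r) = x , r , self
      ... | inj₂ (_ , a , a∈ , p) with free-or-parent a∈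
      ...   | inj₁ (_ , r) = a , r , child self p
      ...   | inj₂ (_ , g , g∈ , q)
        with row-root n (<-≤-trans (subst (λ c → g <[ c ] x) cx (grandparent-≺ p q)) x≤n) g∈
               (trans (sym (opp-involutive (colour g)))
                 (trans (cong opp (sym (Parent-colour q))) (trans (sym (Parent-colour p)) cx)))
      ...     | k , r , d = k , r , child (child d q) p

    has-root : ∀ {x} → x ∈ L → ∃ λ k → RootOf L k × Desc k x
    has-root {x} x∈ with colour x in cx
    ... | white = row-root (suc x) ≤-refl x∈ cx
    ... | black with free-or-parent x∈
    ...   | inj₁ (_ , r) = x , r , self
    ...   | inj₂ (_ , a , a∈ , p)
      with row-root (suc a) ≤-refl a∈
             (trans (sym (opp-involutive (colour a))) (cong opp (trans (sym (Parent-colour p)) cx)))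
    ...     | k , r , d = k , r , child d p

    -- The closure that computes a component

    private
      Saturated : List ℕ → Set
      Saturated X = ∀ {x y} → x ∈ L → y ∈ X → T (adj (tab L) x y) → x ∈ X

      reached : List ℕ → ℕ → Bool
      reached X l = mem l X ∨ any (adj (tab L) l) X

      T-reached : ∀ {X l} → T (reached X l) ⇔ (l ∈ X ⊎ ∃ λ y → y ∈ X × T (adj (tab L) l y))
      T-reached {X} {l} = mk⇔ (λ t → f (to (T-∨ {mem l X}) t)) (from (T-∨ {mem l X}) ∘ g)
        where
        f : T (mem l X) ⊎ T (any (adj (tab L) l) X) → l ∈ X ⊎ ∃ λ y → y ∈ X × T (adj (tab L) l y)
        f (inj₁ t) = inj₁ (to T-mem t)
        f (inj₂ t) = inj₂ (to T-any t)
        g : (l ∈ X ⊎ ∃ λ y → y ∈ X × T (adj (tab L) l y)) → T (mem l X) ⊎ T (any (adj (tab L) l) X)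
        g (inj₁ t) = inj₁ (from T-mem t)
        g (inj₂ t) = inj₂ (from T-any t)

      new : (ℕ → Bool) → ℕ → Bool
      new p x = reached (filterᵇ p L) x ∧ not (p x)

      iterate-stable : ∀ m {f : List ℕ → List ℕ} {X} → f X ≡ X → iterate m f X ≡ X
      iterate-stable zero    e = refl
      iterate-stable (suc m) {f} e = trans (cong (iterate m f) e) (iterate-stable m e)

      -- Each round that adds nothing ends the closure, and at most |L| rounds add something.
      saturate : ∀ m (p : ℕ → Bool) → length L ≤ m + length (filterᵇ p L) →
                 Saturated (iterate m (closeStep (tab L)) (filterᵇ p L))
      saturate zero p h {x} x∈ _ _ with T? (p x)
      ... | yes px = from (∈-filterᵇ L) (x∈ , px)
      -- By `h` the current set is already as long as `L`, so no label of `L` can be missing from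
      -- it.
      ... | no ¬px = ⊥-elim (<-irrefl refl (≤-<-trans h
              (<-≤-trans (length-filterᵇ-strict {q = λ _ → true} L _ x∈ _ ¬px) (length-filterᵇ L))))
      saturate (suc m) p h with T? (any (new p) L)
      ... | yes t with to T-any t
      ...   | x , x∈ , n = saturate-next (to T-∧ n)
        where
        X = filterᵇ p L
        bigger : ∀ {x} → x ∈ L → T (p x) → T (reached X x)
        bigger x∈ px = from T-reached (inj₁ (from (∈-filterᵇ L) (x∈ , px)))
        -- The count of labels needs a predicate that is implied by `p` everywhere, while
        -- `reached X` contains `p` only on `L`. The disjunction repairs this and selects the same
        -- labels of `L`.
        p∨ : ℕ → Bool
        p∨ y = p y ∨ reached X y
        same : filterᵇ p∨ L ≡ closeStep (tab L) X
        same = filterᵇ-cong L λ {y} y∈ → mk⇔ (λ t → merge y∈ (to (T-∨ {p y}) t)) (from (T-∨ {p y}) ∘ inj₂)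
          where
          merge : ∀ {y} → y ∈ L → T (p y) ⊎ T (reached X y) → T (reached X y)
          merge y∈ (inj₁ py) = bigger y∈ py
          merge y∈ (inj₂ ry) = ry
        saturate-next : T (reached X x) × T (not (p x)) → Saturated (iterate m (closeStep (tab L)) (closeStep (tab L) X))
        saturate-next (r , np) = subst (λ Y → Saturated (iterate m (closeStep (tab L)) Y)) same
          (saturate m p∨ (≤-trans h (≤-trans (≤-reflexive (sym (+-suc m _)))
            (+-monoʳ-≤ m (length-filterᵇ-strict {p = p} {q = p∨} L (λ {y} → from (T-∨ {p y}) ∘ inj₁) x∈
              (from (T-∨ {p x}) (inj₂ r)) (to T-not np))))))
      saturate (suc m) p h | no ¬t =
        subst Saturated (sym (iterate-stable (suc m) same)) (λ x∈ y∈ a → subst (_ ∈_) same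
          (from (∈-filterᵇ L) (x∈ , from T-reached (inj₂ (_ , y∈ , a)))))
        where
        X = filterᵇ p L
        same : closeStep (tab L) X ≡ X
        same = filterᵇ-cong L λ {x} x∈ → mk⇔ (old x∈) (λ px → from T-reached (inj₁ (from (∈-filterᵇ L) (x∈ , px))))
          where
          old : ∀ {x} → x ∈ L → T (reached X x) → T (p x)
          old {x} x∈ r with T? (p x)
          ... | yes px = px
          ... | no ¬px = ⊥-elim (¬t (from T-any (x , x∈ , from T-∧ (r , from T-not ¬px))))

      iterate-preserves : ∀ (Q : List ℕ → Set) {f : List ℕ → List ℕ} m → (∀ {X} → Q X → Q (f X)) →
                          ∀ {X} → Q X → Q (iterate m f X)
      iterate-preserves Q zero    h q = q
      iterate-preserves Q (suc m) h q = iterate-preserves Q m h (h q)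

    -- The closure also moves from a label to its parent. Starting from a root this adds nothing:
    -- the root has no parent in `L`, and the parent of any other reached label is, by uniqueness,
    -- the one it descends from.
    ∈-comp : ∀ {k x} → RootOf L k → x ∈ comp (tab L) k ⇔ Desc k x
    ∈-comp {k} (k∈ , no-parent) = mk⇔ sound complete
      where
      n = length L
      sound : ∀ {x} → x ∈ comp (tab L) k → Desc k x
      sound = iterate-preserves (λ X → ∀ {x} → x ∈ X → Desc k x) n closeStep-sound λ { (here refl) → self }
        where
        closeStep-sound : ∀ {X} → (∀ {x} → x ∈ X → Desc k x) → ∀ {x} → x ∈ closeStep (tab L) X → Desc k x
        closeStep-sound {X} h x∈ with to (∈-filterᵇ L) x∈
        ... | x∈L , t with to (T-reached {X}) t
        ...   | inj₁ x∈X = h x∈X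
        ...   | inj₂ (y , y∈ , a) with to T-adj a
        ...     | _ , _ , inj₁ p = child (h y∈) p
        ...     | _ , _ , inj₂ p with h y∈
        ...       | self = ⊥-elim (no-parent x∈L p)
        ...       | child d q = subst (Desc k) (Parent-functional q p) d
      saturated : Saturated (comp (tab L) k)
      saturated with length L in eq | ∈⇒0<length k∈
      -- The first round turns the singleton of `k` into a filtered part of `L`, the form that
      -- `saturate` handles. The round it costs is paid for by `k` itself, which is already in that
      -- part.
      ... | suc m | _ = saturate m (reached (k ∷ [])) (≤-trans (≤-reflexive eq)
              (≤-trans (≤-reflexive (+-comm 1 m)) (+-monoʳ-≤ m (∈⇒0<length
                (from (∈-filterᵇ L) (k∈ , from (T-reached {k ∷ []}) (inj₁ (here refl))))))))
      k∈comp : k ∈ comp (tab L) k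
      k∈comp = iterate-preserves (k ∈_) n
        (λ k∈X → from (∈-filterᵇ L) (k∈ , from T-reached (inj₁ k∈X))) (here refl)
      complete : ∀ {x} → Desc k x → x ∈ comp (tab L) k
      complete self = k∈comp
      complete (child d p) =
        let a∈ = Desc-closed C k∈ d in
        saturated (down C p a∈) (complete d) (from T-adj (down C p a∈ , a∈ , inj₁ p))

    -- A component contains one free label only, so choosing the smallest free label of each
    -- component discards none.
    splitKeys≡Free : splitKeys (tab L) ≡ Free (tab L)
    splitKeys≡Free = filterᵇ-all (Free (tab L)) λ {k} k∈ → from T-not λ t →
      let (k′ , k′∈ , u) = to T-any t
          (k′<k , k′∈comp) = to T-∧ u
          r  = to ∈-Free k∈
          r′ = to ∈-Free k′∈
      in <-irrefl (sym (root-unique C r r′ (to (∈-comp r) (to T-mem k′∈comp)) self)) (<ᵇ⇒< k′ k k′<k)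

  -- Specifications of trees and of sorted forests

  record TreeSpec (k : ℕ) (t : PTree) : Set where
    field
      root-label  : rootLabel t ≡ k
      root-colour : rootColor t ≡ colour k
      ordered     : Ordered (colour k) (t ∷ [])
      fit         : Fits colour Parent t
      letters     : ∀ {x} → x ∈ psi t ⇔ Desc k x
      distinct    : Unique (psi t)

  record ForestSpec (c : Color) (ks : List ℕ) (F : List PTree) : Set where
    field
      ordered  : Ordered c F
      fit      : All (Fits colour Parent) F
      ∈-roots  : ∀ {x} → x ∈ roots F ⇔ x ∈ ks
      letters  : ∀ {x} → x ∈ psiList F ⇔ (∃ λ k → k ∈ ks × Desc k x)
      distinct : Unique (psiList F)

  module _ {c : Color} where

    private
      roots≡ : ∀ {ks F} → Pointwise TreeSpec ks F → roots F ≡ ks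
      roots≡ [] = refl
      roots≡ (s ∷ ss) = cong₂ _∷_ (TreeSpec.root-label s) (roots≡ ss)

      all-ordered : ∀ {ks F} → Pointwise TreeSpec ks F → (∀ {k} → k ∈ ks → colour k ≡ c) →
                    All (λ t → Ordered c (t ∷ [])) F
      all-ordered [] h = []
      all-ordered (s ∷ ss) h =
        subst (λ c → Ordered c _) (h (here refl)) (TreeSpec.ordered s) ∷ all-ordered ss (h ∘ there)

      all-fit : ∀ {ks F} → Pointwise TreeSpec ks F → All (Fits colour Parent) F
      all-fit [] = []
      all-fit (s ∷ ss) = TreeSpec.fit s ∷ all-fit ss

      ∈-letters⁻ : ∀ {ks F x} → Pointwise TreeSpec ks F → x ∈ psiList F → ∃ λ k → k ∈ ks × Desc k x
      ∈-letters⁻ {F = t ∷ F} (s ∷ ss) x∈ with ∈-++⁻ (psi t) x∈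
      ... | inj₁ q = _ , here refl , to (TreeSpec.letters s) q
      ... | inj₂ q = let (k , k∈ , d) = ∈-letters⁻ ss q in k , there k∈ , d

      ∈-letters⁺ : ∀ {ks F x k} → Pointwise TreeSpec ks F → k ∈ ks → Desc k x → x ∈ psiList F
      ∈-letters⁺ (s ∷ ss) (here refl) d = ∈-++⁺ˡ (from (TreeSpec.letters s) d)
      ∈-letters⁺ {F = t ∷ F} (s ∷ ss) (there k∈) d = ∈-++⁺ʳ (psi t) (∈-letters⁺ ss k∈ d)

      Disjoint-trees : List ℕ → Set
      Disjoint-trees ks = ∀ {k k′ x} → k ∈ ks → k′ ∈ ks → Desc k x → Desc k′ x → k ≡ k′

      all-distinct : ∀ {ks F} → Pointwise TreeSpec ks F → Unique ks → Disjoint-trees ks → Unique (psiList F)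
      all-distinct [] _ _ = []
      all-distinct (s ∷ ss) (k∉ ∷ u) h = Uniqueₚ.++⁺ (TreeSpec.distinct s)
        (all-distinct ss u (λ k∈ k′∈ → h (there k∈) (there k′∈)))
        (λ (p , q) → let (k , k∈ , d) = ∈-letters⁻ ss q in
          All.lookup k∉ k∈ (h (here refl) (there k∈) (to (TreeSpec.letters s) p) d))

    sorted-forest : ∀ {ks F} → Pointwise TreeSpec ks F → Unique ks → (∀ {k} → k ∈ ks → colour k ≡ c) →
                    Disjoint-trees ks → ForestSpec c ks (sortC c F)
    sorted-forest {ks} {F} ss u hc hd = record
      { ordered  = sortC-Ordered c F (all-ordered ss hc) (subst Unique (sym (roots≡ ss)) u)
      ; fit      = Permₚ.All-resp-↭ (↭-sym (sortC-↭ c F)) (all-fit ss)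
      ; ∈-roots  = mk⇔
          (λ x∈ → subst (_ ∈_) (roots≡ ss) (Permₚ.∈-resp-↭ (Permₚ.map⁺ rootLabel (sortC-↭ c F)) x∈))
          (λ x∈ → Permₚ.∈-resp-↭ (Permₚ.map⁺ rootLabel (↭-sym (sortC-↭ c F))) (subst (_ ∈_) (sym (roots≡ ss)) x∈))
      ; letters  = mk⇔
          (λ x∈ → ∈-letters⁻ ss (Permₚ.∈-resp-↭ (psiList-↭ (sortC-↭ c F)) x∈))
          (λ (k , k∈ , d) → Permₚ.∈-resp-↭ (psiList-↭ (↭-sym (sortC-↭ c F))) (∈-letters⁺ ss k∈ d))
      ; distinct = Unique-↭ (psiList-↭ (↭-sym (sortC-↭ c F))) (all-distinct ss u hd)
      }

  Parent-irrefl : ∀ {x} → ¬ Parent x x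
  Parent-irrefl {x} p with colour x | Parent-colour p
  ... | white | ()
  ... | black | ()

  -- A component and the cut at its root

  component : List ℕ → ℕ → List ℕ
  component L k = filterᵇ (λ l → mem l (comp (tab L) k)) L

  cut : ℕ → List ℕ → List ℕ
  cut k L = filterᵇ (λ l → not (l ≡ᵇ k)) L

  module Component {L k} (C : Closed L) (r : RootOf L k) where

    Lₖ : List ℕ
    Lₖ = component L k

    ∈-component : ∀ {x} → x ∈ Lₖ ⇔ Desc k x
    ∈-component = mk⇔ (λ x∈ → to (∈-comp C r) (to T-mem (proj₂ (to (∈-filterᵇ L) x∈))))
                      (λ d → from (∈-filterᵇ L) (Desc-closed C (proj₁ r) d , from T-mem (from (∈-comp C r) d)))

    component⊆ : ∀ {x} → x ∈ Lₖ → x ∈ L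
    component⊆ x∈ = proj₁ (to (∈-filterᵇ L) x∈)

    component-closed : Closed Lₖ
    component-closed = record
      { ⊆L₀    = λ x∈ → ⊆L₀ C (component⊆ x∈)
      ; unique = filterᵇ-Unique (unique C)
      ; down   = λ p a∈ → from ∈-component (child (to ∈-component a∈) p)
      }

    component-root : RootOf Lₖ k
    component-root = from ∈-component self , λ a∈ → proj₂ r (component⊆ a∈)

    -- The component is a packed tableau, so the counts of free rows and columns that `treeF` tests
    -- reveal the colour of `k`.
    component-Free : Free (tab Lₖ) ≡ k ∷ []
    component-Free = Unique-singleton (filterᵇ-Unique (unique component-closed))
      (from (∈-Free component-closed) component-root)
      (λ x∈ → let r′ = to (∈-Free component-closed) x∈ in
        sym (root-unique component-closed component-root r′ (to ∈-component (proj₁ r′)) self))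

    L′ : List ℕ
    L′ = cut k Lₖ

    ∈-cut : ∀ {x} → x ∈ L′ ⇔ (Desc k x × x ≢ k)
    ∈-cut {x} = mk⇔
      (λ x∈ → let (x∈ₖ , n) = to (∈-filterᵇ Lₖ) x∈ in to ∈-component x∈ₖ , λ e → to T-not n (≡⇒≡ᵇ x k e))
      (λ (d , x≢k) → from (∈-filterᵇ Lₖ) (from ∈-component d , from T-not (λ t → x≢k (≡ᵇ⇒≡ x k t))))

    cut-closed : Closed L′
    cut-closed = record
      { ⊆L₀    = λ x∈ → ⊆L₀ component-closed (proj₁ (to (∈-filterᵇ Lₖ) x∈))
      ; unique = filterᵇ-Unique (unique component-closed)
      ; down   = λ p a∈ → let (d , _) = to ∈-cut a∈ in
          from ∈-cut (child d p , λ { refl → proj₂ component-root (from ∈-component d) p })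
      }

    -- Deleting `k` takes the parent away from exactly the children of `k`; every other label keeps
    -- its only parent.
    cut-roots : ∀ {x} → RootOf L′ x ⇔ Parent x k
    cut-roots = mk⇔ root⇒child
      (λ p → from ∈-cut (child self p , λ { refl → Parent-irrefl p }) ,
             λ a∈ p′ → proj₂ (to ∈-cut a∈) (Parent-functional p′ p))
      where
      root⇒child : ∀ {x} → RootOf L′ x → Parent x k
      root⇒child (x∈ , np) = let (d , x≢k) = to ∈-cut x∈ in parent d x≢k np
        where
        parent : ∀ {x} → Desc k x → x ≢ k → (∀ {a} → a ∈ L′ → ¬ Parent x a) → Parent x k
        parent self x≢k np = ⊥-elim (x≢k refl)
        parent (child {a} d p) _ np with a ≟ k
        ... | yes refl = p
        ... | no a≢k   = ⊥-elim (np (from ∈-cut (d , a≢k)) p)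

    cut-shorter : length L′ < length Lₖ
    cut-shorter = <-≤-trans
      (length-filterᵇ-strict {q = λ _ → true} Lₖ _ (proj₁ component-root) _
        (λ n → to T-not n (≡⇒≡ᵇ k k refl)))
      (length-filterᵇ Lₖ)

  nFreeRows-one : ∀ U {k} → Free U ≡ k ∷ [] → nFreeRows U ≡ (if LT.isRowL U k then 1 else 0)
  nFreeRows-one U {k} e rewrite e with LT.isRowL U k
  ... | true  = refl
  ... | false = refl

  nFreeCols-one : ∀ U {k} → Free U ≡ k ∷ [] → nFreeCols U ≡ (if LT.isRowL U k then 0 else 1)
  nFreeCols-one U {k} e rewrite e with LT.isRowL U k
  ... | true  = refl
  ... | false = refl

  treeF-white : ∀ f U {k} → Free U ≡ k ∷ [] → LT.isRowL U k ≡ true → topRow U ≡ just k →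
                treeF (suc f) U ≡ node white k (sortDec (map (treeF f) (split (cutAt k U))))
  treeF-white f U e e′ e″ rewrite nFreeRows-one U e | nFreeCols-one U e | e′ | e″ = refl

  treeF-black : ∀ f U {k} → Free U ≡ k ∷ [] → LT.isRowL U k ≡ false → leftCol U ≡ just k →
                treeF (suc f) U ≡ node black k (sortInc (map (treeF f) (split (cutAt k U))))
  treeF-black f U e e′ e″ rewrite nFreeRows-one U e | e′ | e″ = refl

  module _ {L k} (C : Closed L) (r : RootOf L k) where
    open Component C r

    -- `treeF` takes as root label the smallest row or the largest column, not the free label. By
    -- `Desc-≺` the free label precedes all the others of its component, hence is that extremal one.
    treeF-component : ∀ f → treeF (suc f) (tab Lₖ) ≡
                      node (colour k) k (sortC (opp (colour k)) (map (treeF f) (split (tab L′))))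
    treeF-component f = by-row (row k) refl
      where
      extremal : ∀ {x} → x ∈ Lₖ → x ≡ k ⊎ k <[ colour k ] x
      extremal x∈ = Desc-≺ (to ∈-component x∈)
      by-row : ∀ b → row k ≡ b → treeF (suc f) (tab Lₖ) ≡
               node (if b then white else black) k
                 (sortC (opp (if b then white else black)) (map (treeF f) (split (tab L′))))
      by-row true rk = treeF-white f (tab Lₖ) component-Free rk
        (minL-unique (from (∈-filterᵇ Lₖ) (proj₁ component-root , from T-≡ rk))
                     (λ x∈ → least (extremal (proj₁ (to (∈-filterᵇ Lₖ) x∈)))))
        where
        least : ∀ {x} → x ≡ k ⊎ k <[ colour k ] x → k ≤ x
        least (inj₁ refl) = ≤-refl
        least (inj₂ p) rewrite rk = <⇒≤ p
      by-row false rk = treeF-black f (tab Lₖ) component-Free rk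
        (maxL-unique (from (∈-filterᵇ Lₖ) (proj₁ component-root , from T-not-≡ rk))
                     (λ x∈ → greatest (extremal (proj₁ (to (∈-filterᵇ Lₖ) x∈)))))
        where
        greatest : ∀ {x} → x ≡ k ⊎ k <[ colour k ] x → x ≤ k
        greatest (inj₁ refl) = ≤-refl
        greatest (inj₂ p) rewrite rk = <⇒≤ p

  split-spec : ∀ {L} (C : Closed L) {g : LT → PTree} →
               (∀ {k} → RootOf L k → TreeSpec k (g (tab (component L k)))) →
               Pointwise TreeSpec (Free (tab L)) (map g (split (tab L)))
  split-spec {L} C {g} h =
    subst (λ ks → Pointwise TreeSpec (Free (tab L)) (map g (map (λ k → restrict (tab L) (comp (tab L) k)) ks)))
      (sym (splitKeys≡Free C)) (specs (Free (tab L)) (to (∈-Free C)))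
    where
    specs : ∀ ks → (∀ {k} → k ∈ ks → RootOf L k) →
            Pointwise TreeSpec ks (map g (map (λ k → restrict (tab L) (comp (tab L) k)) ks))
    specs [] _ = []
    specs (k ∷ ks) r = h (r (here refl)) ∷ specs ks (r ∘ there)

  children-forest : ∀ {L} (C : Closed L) {c F} → Pointwise TreeSpec (Free (tab L)) F →
                    (∀ {k} → RootOf L k → colour k ≡ c) → ForestSpec c (Free (tab L)) (sortC c F)
  children-forest C ss hc = sorted-forest ss (filterᵇ-Unique (unique C)) (λ k∈ → hc (to (∈-Free C) k∈))
    (λ k∈ k′∈ → root-unique C (to (∈-Free C) k∈) (to (∈-Free C) k′∈))

  module _ {L k} (C : Closed L) (r : RootOf L k) {us : List PTree} where
    open Component C r

    node-spec : ForestSpec (opp (colour k)) (Free (tab L′)) us → TreeSpec k (node (colour k) k us)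
    node-spec G = record
      { root-label  = refl
      ; root-colour = refl
      ; ordered     = tree (All.tabulate above) [] G.ordered []
      ; fit         = fits refl (λ b → mk⇔
          (λ p → from G.∈-roots (from (∈-Free cut-closed) (from cut-roots p)))
          (λ b∈ → to cut-roots (to (∈-Free cut-closed) (to G.∈-roots b∈)))) G.fit
      ; letters     = mk⇔ letters⁻ letters⁺
      ; distinct    = Uniqueₚ.++⁺ G.distinct ([] ∷ []) λ { (p , here refl) → proj₂ (to ∈-cut (in-cut p)) refl }
      }
      where
      module G = ForestSpec G
      in-cut : ∀ {x} → x ∈ psiList us → x ∈ L′
      in-cut x∈ with to G.letters x∈
      ... | k′ , k′∈ , d = Desc-closed cut-closed (proj₁ (to (∈-Free cut-closed) k′∈)) d
      above : ∀ {x} → x ∈ psiList us → k <[ colour k ] x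
      above x∈ with to ∈-cut (in-cut x∈)
      ... | d , x≢k with Desc-≺ d
      ...   | inj₁ e = ⊥-elim (x≢k e)
      ...   | inj₂ p = p
      letters⁻ : ∀ {x} → x ∈ psiList us ++ k ∷ [] → Desc k x
      letters⁻ x∈ with ∈-++⁻ (psiList us) x∈
      ... | inj₁ p = proj₁ (to ∈-cut (in-cut p))
      ... | inj₂ (here refl) = self
      letters⁺ : ∀ {x} → Desc k x → x ∈ psiList us ++ k ∷ []
      letters⁺ {x} d with x ≟ k
      ... | yes refl = ∈-insert (psiList us)
      ... | no x≢k with has-root cut-closed (from ∈-cut (d , x≢k))
      ...   | k′ , r′ , d′ = ∈-++⁺ˡ (from G.letters (k′ , from (∈-Free cut-closed) r′ , d′))

  treeF-spec : ∀ f {L} (C : Closed L) {k} → RootOf L k → length (component L k) ≤ f →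
               TreeSpec k (treeF f (tab (component L k)))
  treeF-spec zero C r l = ⊥-elim (<-irrefl refl (<-≤-trans (∈⇒0<length (proj₁ (Component.component-root C r))) l))
  treeF-spec (suc f) {L} C {k} r l = subst (TreeSpec k) (sym (treeF-component C r f))
    (node-spec C r (children-forest cut-closed
      (split-spec cut-closed {g = treeF f} λ r′ → treeF-spec f cut-closed r′
        (≤-trans (length-filterᵇ L′) (≤-pred (≤-trans cut-shorter l))))
      (λ r′ → Parent-colour (to cut-roots r′))))
    where open Component C r

  Pointwise-filterᵇ : ∀ {p q ks F} → (∀ {k t} → TreeSpec k t → p k ≡ q t) → Pointwise TreeSpec ks F →
                      Pointwise TreeSpec (filterᵇ p ks) (filterᵇ q F)
  Pointwise-filterᵇ h [] = []
  Pointwise-filterᵇ {p} {q} {k ∷ _} {t ∷ _} h (s ∷ ss) with p k | q t | h s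
  ... | true  | _ | refl = s ∷ Pointwise-filterᵇ h ss
  ... | false | _ | refl = Pointwise-filterᵇ h ss

  isWhite-root : ∀ {k t} → TreeSpec k t → row k ≡ isWhite t
  isWhite-root {k} {t} s with rootColor t | row k | TreeSpec.root-colour s
  ... | white | true  | refl = refl
  ... | black | false | refl = refl

  -- The forest of the whole tableau

  module Top (u : Unique L₀) where

    L₀-closed : Closed L₀
    L₀-closed = record { ⊆L₀ = λ x∈ → x∈ ; unique = u ; down = λ p _ → proj₁ p }

    private
      trees : Pointwise TreeSpec (Free (tab L₀)) (Forest (tab L₀))
      trees = split-spec L₀-closed {g = Tree} (λ r → treeF-spec _ L₀-closed r ≤-refl)

    blacks whites : List PTree
    blacks = sortDec (filterᵇ (λ t → not (isWhite t)) (Forest (tab L₀)))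
    whites = sortInc (filterᵇ isWhite (Forest (tab L₀)))

    private
      disjoint : ∀ {p : ℕ → Bool} {k k′ x} → k ∈ filterᵇ p (Free (tab L₀)) → k′ ∈ filterᵇ p (Free (tab L₀)) →
                 Desc k x → Desc k′ x → k ≡ k′
      disjoint k∈ k′∈ = root-unique L₀-closed (root k∈) (root k′∈)
        where
        root : ∀ {p k} → k ∈ filterᵇ p (Free (tab L₀)) → RootOf L₀ k
        root k∈ = to (∈-Free L₀-closed) (proj₁ (to (∈-filterᵇ (Free (tab L₀))) k∈))
      free-unique : ∀ {p} → Unique (filterᵇ p (Free (tab L₀)))
      free-unique = filterᵇ-Unique (filterᵇ-Unique u)

    whites-spec : ForestSpec white (filterᵇ row (Free (tab L₀))) whites
    whites-spec = sorted-forest {white} (Pointwise-filterᵇ isWhite-root trees) free-unique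
      (λ k∈ → cong (λ b → if b then white else black) (to T-≡ (proj₂ (to (∈-filterᵇ (Free (tab L₀))) k∈))))
      disjoint

    blacks-spec : ForestSpec black (filterᵇ (λ k → not (row k)) (Free (tab L₀))) blacks
    blacks-spec = sorted-forest {black} (Pointwise-filterᵇ (cong not ∘ isWhite-root) trees) free-unique
      (λ k∈ → cong (λ b → if b then white else black) (to T-not-≡ (proj₂ (to (∈-filterᵇ (Free (tab L₀))) k∈))))
      disjoint

-- The vertices of a forest

module _ where
  open import Data.List.Membership.DecPropositional _≟_ using (_∈?_)

  -- Colour and child labels of a vertex, with the junk value (white , []) off the forest.
  vertex : List PTree → ℕ → Color × List ℕ
  vertex [] x = white , []
  vertex (node c m us ∷ ts) x with x ≟ m | x ∈? psiList us
  ... | yes _ | _     = c , roots us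
  ... | no _  | yes _ = vertex us x
  ... | no _  | no _  = vertex ts x

  vertex-root : ∀ {c m} us ts → vertex (node c m us ∷ ts) m ≡ (c , roots us)
  vertex-root {c} {m} us ts with m ≟ m | m ∈? psiList us
  ... | yes _ | _ = refl
  ... | no ¬e | _ = ⊥-elim (¬e refl)

  vertex-sub : ∀ {c m x} us ts → x ≢ m → x ∈ psiList us → vertex (node c m us ∷ ts) x ≡ vertex us x
  vertex-sub {c} {m} {x} us ts x≢m x∈ with x ≟ m | x ∈? psiList us
  ... | yes e | _      = ⊥-elim (x≢m e)
  ... | no _  | yes _  = refl
  ... | no _  | no x∉  = ⊥-elim (x∉ x∈)

  vertex-rest : ∀ {c m x} us ts → x ≢ m → x ∉ psiList us → vertex (node c m us ∷ ts) x ≡ vertex ts x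
  vertex-rest {c} {m} {x} us ts x≢m x∉ with x ≟ m | x ∈? psiList us
  ... | yes e | _      = ⊥-elim (x≢m e)
  ... | no _  | yes x∈ = ⊥-elim (x∉ x∈)
  ... | no _  | no _   = refl

  vertexColour : List PTree → ℕ → Color
  vertexColour F x = proj₁ (vertex F x)

  Child : List PTree → ℕ → ℕ → Set
  Child F b a = b ∈ proj₂ (vertex F a)

  Child? : ∀ F b a → Dec (Child F b a)
  Child? F b a = b ∈? proj₂ (vertex F a)

  record DistinctNode (m : ℕ) (us ts : List PTree) : Set where
    field
      sub      : Unique (psiList us)
      rest     : Unique (psiList ts)
      root∉sub : m ∉ psiList us
      root∉rest : m ∉ psiList ts
      disjoint : ∀ {x} → x ∈ psiList us → x ∉ psiList ts

  distinct-node : ∀ {c m us ts} → Unique (psiList (node c m us ∷ ts)) → DistinctNode m us ts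
  distinct-node {c} {m} {us} {ts} u with subst Unique (psiList-∷ {c} us ts) u
  ... | v with Unique-++⁻ (psiList us) v
  ...   | uus , (m∉ ∷ uts) = record
    { sub      = uus
    ; rest     = uts
    ; root∉sub = λ m∈ → Unique-disjoint (psiList us) v m∈ (here refl)
    ; root∉rest = λ m∈ → All.lookup m∉ m∈ refl
    ; disjoint = λ p q → Unique-disjoint (psiList us) v p (there q)
    }

  -- A forest with distinct letters is drawn from its own colours and children: distinctness makes
  -- each lookup stop at the intended vertex. The child relation obtained is decidable, so arrows
  -- can be computed from it.
  vertex-fits : ∀ F → Unique (psiList F) → All (Fits (vertexColour F) (Child F)) F
  vertex-fits [] u = []
  vertex-fits F@(node c m us ∷ ts) u =
    fits (cong proj₁ at-root) (λ b → mk⇔ (subst (b ∈_) (cong proj₂ at-root)) (subst (b ∈_) (sym (cong proj₂ at-root))))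
      (Fits-cong us (λ x∈ → same (sym (vertex-sub {c} us ts (λ { refl → root∉sub x∈ }) x∈))) (vertex-fits us sub))
    ∷ Fits-cong ts (λ x∈ → same (sym (vertex-rest {c} us ts (λ { refl → root∉rest x∈ }) (λ q → disjoint q x∈))))
        (vertex-fits ts rest)
    where
    open DistinctNode (distinct-node {c} {m} {us} {ts} u)
    at-root : vertex F m ≡ (c , roots us)
    at-root = vertex-root {c} {m} us ts
    same : ∀ {v w : Color × List ℕ} → v ≡ w → proj₁ v ≡ proj₁ w × (∀ b → b ∈ proj₂ v ⇔ b ∈ proj₂ w)
    same refl = refl , λ b → mk⇔ (λ p → p) (λ p → p)

  module _ {col : ℕ → Color} {P : ℕ → ℕ → Set} where

    child∉roots : ∀ {c F} → Ordered c F → All (Fits col P) F → Unique (psiList F) →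
                  ∀ {a b} → a ∈ psiList F → P b a → b ∉ roots F
    child∉roots {c} (tree {m = m} {us} {ts} a b o o′) (fits e k φ ∷ φ′) u a∈ p = go (∈-word⁻ {c} us ts a∈)
      where
      open DistinctNode (distinct-node {c} {m} {us} {ts} u)
      in-sub : ∀ {b} → b ∈ psiList us → b ∉ m ∷ roots ts
      in-sub b∈ (here refl) = root∉sub b∈
      in-sub b∈ (there q)   = disjoint b∈ (∈-roots⇒∈-word ts q)
      in-rest : ∀ {b} → b ∈ psiList ts → b ∉ roots ts → b ∉ m ∷ roots ts
      in-rest b∈ _ (here refl)  = root∉rest b∈
      in-rest _  b∉ (there q)   = b∉ q
      go : _ → _ ∉ m ∷ roots ts
      go (inj₁ q)           = in-sub (proj₁ (child-of o φ q p))
      go (inj₂ (inj₁ refl)) = in-sub (∈-roots⇒∈-word us (to (k _) p))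
      go (inj₂ (inj₂ q))    = in-rest (proj₁ (child-of o′ φ′ q p)) (child∉roots o′ φ′ rest q p)

    -- The letter `b` occurs only once. Two distinct parents would place it both below the first
    -- root and among its siblings' trees, or both as a root and strictly inside the same subforest.
    parent-unique : ∀ {c F} → Ordered c F → All (Fits col P) F → Unique (psiList F) →
                    ∀ {a a′ b} → a ∈ psiList F → a′ ∈ psiList F → P b a → P b a′ → a ≡ a′
    parent-unique {c} (tree {m = m} {us} {ts} _ _ o o′) (fits e k φ ∷ φ′) u {a} {a′} {b} a∈ a′∈ p p′ =
      go (∈-word⁻ {c} us ts a∈) (∈-word⁻ {c} us ts a′∈)
      where
      open DistinctNode (distinct-node {c} {m} {us} {ts} u)
      under-root : ∀ {a} → a ≡ m → P b a → b ∈ roots us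
      under-root refl p = to (k _) p
      clash : b ∈ psiList us → b ∈ psiList ts → a ≡ a′
      clash q r = ⊥-elim (disjoint q r)
      go : _ → _ → a ≡ a′
      go (inj₁ q) (inj₁ q′) = parent-unique o φ sub q q′ p p′
      go (inj₁ q) (inj₂ (inj₁ e)) = ⊥-elim (child∉roots o φ sub q p (under-root e p′))
      go (inj₁ q) (inj₂ (inj₂ q′)) = clash (proj₁ (child-of o φ q p)) (proj₁ (child-of o′ φ′ q′ p′))
      go (inj₂ (inj₁ e)) (inj₁ q′) = ⊥-elim (child∉roots o φ sub q′ p′ (under-root e p))
      go (inj₂ (inj₁ refl)) (inj₂ (inj₁ refl)) = refl
      go (inj₂ (inj₁ e)) (inj₂ (inj₂ q′)) =
        clash (∈-roots⇒∈-word us (under-root e p)) (proj₁ (child-of o′ φ′ q′ p′))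
      go (inj₂ (inj₂ q)) (inj₁ q′) = clash (proj₁ (child-of o φ q′ p′)) (proj₁ (child-of o′ φ′ q p))
      go (inj₂ (inj₂ q)) (inj₂ (inj₁ e)) =
        clash (∈-roots⇒∈-word us (under-root e p′)) (proj₁ (child-of o′ φ′ q p))
      go (inj₂ (inj₂ q)) (inj₂ (inj₂ q′)) = parent-unique o′ φ′ rest q q′ p p′

    root-or-child : ∀ {F} → All (Fits col P) F → ∀ {x} → x ∈ psiList F →
                    x ∈ roots F ⊎ ∃ λ a → a ∈ psiList F × P x a
    root-or-child {node c m us ∷ ts} (fits e k φ ∷ φ′) x∈ with ∈-word⁻ {c} us ts x∈
    ... | inj₂ (inj₁ refl) = inj₁ (here refl)
    ... | inj₁ q with root-or-child φ q
    ...   | inj₁ r = inj₂ (m , ∈-word-root {c} us ts , from (k _) r)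
    ...   | inj₂ (a , a∈ , p) = inj₂ (a , ∈-word-sub {c} us ts a∈ , p)
    root-or-child {node c m us ∷ ts} (fits e k φ ∷ φ′) x∈ | inj₂ (inj₂ q) with root-or-child φ′ q
    ...   | inj₁ r = inj₁ (there r)
    ...   | inj₂ (a , a∈ , p) = inj₂ (a , ∈-word-rest {c} us ts a∈ , p)

-- The tableau and its labels

label : ∀ {n} → Fin n → ℕ
label i = suc (toℕ i)

standardLabels : ℕ → List ℕ
standardLabels n = map suc (upTo n)

∈-standardLabels : ∀ {n x} → x ∈ standardLabels n ⇔ (∃ λ (i : Fin n) → x ≡ label i)
∈-standardLabels {n} = mk⇔
  (λ x∈ → let (k , k∈ , e) = ∈-map⁻ suc x∈ ; k<n = ∈-upTo⁻ k∈ in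
    fromℕ< k<n , trans e (cong suc (sym (toℕ-fromℕ< k<n))))
  (λ { (i , refl) → ∈-map⁺ suc (∈-upTo⁺ (toℕ<n i)) })

label∈ : ∀ {n} (i : Fin n) → label i ∈ standardLabels n
label∈ i = from ∈-standardLabels (i , refl)

zero-or-label : ∀ {n x} → x ≤ n → x ≡ 0 ⊎ ∃ λ (i : Fin n) → x ≡ label i
zero-or-label z≤n       = inj₁ refl
zero-or-label (s≤s {m} x≤n) = inj₂ (fromℕ< (s≤s x≤n) , cong suc (sym (toℕ-fromℕ< (s≤s x≤n))))

vget-lookupV : ∀ {A : Set} {d : A} {n} (v : Vec A n) i → vget d v (toℕ i) ≡ lookupV v i
vget-lookupV (x ∷ v) Fin.zero    = refl
vget-lookupV (x ∷ v) (Fin.suc i) = vget-lookupV v i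

lookupV-ext : ∀ {A : Set} {n} {v w : Vec A n} → (∀ i → lookupV v i ≡ lookupV w i) → v ≡ w
lookupV-ext {v = []}    {[]}    h = refl
lookupV-ext {v = x ∷ v} {y ∷ w} h = cong₂ _∷_ (h Fin.zero) (lookupV-ext (h ∘ Fin.suc))

lookupV-tabulate : ∀ {A : Set} {n} (f : Fin n → A) i → lookupV (Vec.tabulate f) i ≡ f i
lookupV-tabulate f Fin.zero    = refl
lookupV-tabulate f (Fin.suc i) = lookupV-tabulate (f ∘ Fin.suc) i

module Tableau {n : ℕ} (T : AltTableau n) where

  arr-entry : ∀ i j → LT.arr (toLT T) (label i) (label j) ≡ entry (fill T) i j
  arr-entry i j rewrite vget-lookupV {d = Vec.replicate n emp} (fill T) i = vget-lookupV (lookupV (fill T) i) j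

  row-shape : ∀ i → LT.isRowL (toLT T) (label i) ≡ lookupV (shape T) i
  row-shape i = vget-lookupV (shape T) i

  private
    arr-left : ∀ {i j j′} → i ∈ standardLabels n → j ∈ standardLabels n → j′ ∈ standardLabels n →
               LT.arr (toLT T) i j ≡ left → j < j′ → LT.arr (toLT T) i j′ ≡ emp
    arr-left i∈ j∈ j′∈ e l with to ∈-standardLabels i∈ | to ∈-standardLabels j∈ | to ∈-standardLabels j′∈
    ... | i , refl | j , refl | j′ , refl =
      trans (arr-entry i j′) (leftOK T i j j′ (trans (sym (arr-entry i j)) e) (≤-pred l))

    arr-up : ∀ {i i′ j} → i ∈ standardLabels n → i′ ∈ standardLabels n → j ∈ standardLabels n →
             LT.arr (toLT T) i j ≡ up → i′ < i → LT.arr (toLT T) i′ j ≡ emp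
    arr-up i∈ i′∈ j∈ e l with to ∈-standardLabels i∈ | to ∈-standardLabels i′∈ | to ∈-standardLabels j∈
    ... | i , refl | i′ , refl | j , refl =
      trans (arr-entry i′ j) (upOK T i i′ j (trans (sym (arr-entry i j)) e) (≤-pred l))

  open Inherited (standardLabels n) (LT.isRowL (toLT T)) (LT.arr (toLT T)) arr-left arr-up public

  -- `Parent` alone may also come from an up arrow in column `i`, stored at the transposed position;
  -- `IsRow` selects the left arrow.
  entry-left : ∀ {i j} → entry (fill T) i j ≡ left ⇔ (IsRow T i × Parent (label i) (label j))
  entry-left {i} {j} = mk⇔ f g
    where
    f : entry (fill T) i j ≡ left → IsRow T i × Parent (label i) (label j)
    f e with onCells T i j (λ e′ → case trans (sym e) e′ of λ ())
    ... | r , c , l = r , label∈ i , label∈ j ,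
      inj₁ ((trans (row-shape i) r , trans (row-shape j) c , s≤s l) , trans (arr-entry i j) e)
    g : IsRow T i × Parent (label i) (label j) → entry (fill T) i j ≡ left
    g (r , _ , _ , inj₁ (_ , e)) = trans (sym (arr-entry i j)) e
    g (r , _ , _ , inj₂ ((_ , c , _) , _)) with () ← trans (sym r) (trans (sym (row-shape i)) c)

  entry-up : ∀ {i j} → entry (fill T) i j ≡ up ⇔ (IsRow T i × Parent (label j) (label i))
  entry-up {i} {j} = mk⇔ f g
    where
    f : entry (fill T) i j ≡ up → IsRow T i × Parent (label j) (label i)
    f e with onCells T i j (λ e′ → case trans (sym e) e′ of λ ())
    ... | r , c , l = r , label∈ j , label∈ i ,
      inj₂ ((trans (row-shape i) r , trans (row-shape j) c , s≤s l) , trans (arr-entry i j) e)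
    g : IsRow T i × Parent (label j) (label i) → entry (fill T) i j ≡ up
    g (r , _ , _ , inj₂ (_ , e)) = trans (sym (arr-entry i j)) e
    g (r , _ , _ , inj₁ ((_ , c , _) , _)) with () ← trans (sym r) (trans (sym (row-shape i)) c)

  IsRoot : ℕ → Set
  IsRoot = RootOf (standardLabels n)

  FreeRow⇔root : ∀ {i} → IsFreeRow T i ⇔ (IsRow T i × IsRoot (label i))
  FreeRow⇔root {i} = mk⇔ f g
    where
    f : IsFreeRow T i → IsRow T i × IsRoot (label i)
    f (r , h) = r , label∈ i , no-parent
      where
      no-parent : ∀ {a} → a ∈ standardLabels n → ¬ Parent (label i) a
      no-parent a∈ p with to ∈-standardLabels a∈
      ... | j , refl = h j (from entry-left (r , p))
    g : IsRow T i × IsRoot (label i) → IsFreeRow T i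
    g (r , _ , h) = r , λ j e → h (label∈ j) (proj₂ (to entry-left e))

  FreeCol⇔root : ∀ {j} → IsFreeCol T j ⇔ (IsCol T j × IsRoot (label j))
  FreeCol⇔root {j} = mk⇔ f g
    where
    f : IsFreeCol T j → IsCol T j × IsRoot (label j)
    f (c , h) = c , label∈ j , no-parent
      where
      no-parent : ∀ {a} → a ∈ standardLabels n → ¬ Parent (label j) a
      no-parent a∈ p with to ∈-standardLabels a∈ | proj₂ (proj₂ p)
      ... | i , refl | inj₂ ((r , _) , _) = h i (from entry-up (trans (sym (row-shape i)) r , p))
      ... | i , refl | inj₁ ((r , _) , _) with () ← trans (sym r) (trans (row-shape j) c)
    g : IsCol T j × IsRoot (label j) → IsFreeCol T j
    g (c , _ , h) = c , λ i e → h (label∈ i) (proj₂ (to entry-up e))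

  colour-row : ∀ {i} → IsRow T i ⇔ colour (label i) ≡ white
  colour-row {i} rewrite row-shape i with lookupV (shape T) i
  ... | true  = mk⇔ (λ _ → refl) (λ _ → refl)
  ... | false = mk⇔ (λ ()) (λ ())

  colour-col : ∀ {i} → IsCol T i ⇔ colour (label i) ≡ black
  colour-col {i} rewrite row-shape i with lookupV (shape T) i
  ... | true  = mk⇔ (λ ()) (λ ())
  ... | false = mk⇔ (λ _ → refl) (λ _ → refl)

  -- As 0 is smaller than every label, placing it over the black trees turns
  -- the whole forest into a white forest whose word is Φ_N(T).
  record Encodes (B W : List PTree) : Set where
    field
      ordered  : Ordered white (node white 0 B ∷ W)
      fit-B    : All (Fits colour Parent) B
      fit-W    : All (Fits colour Parent) W
      roots-B  : ∀ {x} → x ∈ roots B ⇔ (colour x ≡ black × IsRoot x)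
      roots-W  : ∀ {x} → x ∈ roots W ⇔ (colour x ≡ white × IsRoot x)

  -- Identifies the forest computed by `Tree` with any forest found by other means; surjectivity
  -- rests on it.
  Encodes-unique : ∀ {B W B′ W′} → Encodes B W → Encodes B′ W′ → B ≡ B′ × W ≡ W′
  Encodes-unique E E′ with Encodes.ordered E | Encodes.ordered E′
  ... | tree _ _ oB oW | tree _ _ oB′ oW′ =
    Fits-unique oB oB′ E.fit-B E′.fit-B (λ x → mk⇔ (from E′.roots-B ∘ to E.roots-B) (from E.roots-B ∘ to E′.roots-B)) ,
    Fits-unique oW oW′ E.fit-W E′.fit-W (λ x → mk⇔ (from E′.roots-W ∘ to E.roots-W) (from E.roots-W ∘ to E′.roots-W))
    where
    module E = Encodes E
    module E′ = Encodes E′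

  -- The facts about the computed forest, stated for variables `B` and `W`, so that what follows
  -- does not depend on how `Tree` and the sorting produce it.
  record Drawing (B W : List PTree) : Set where
    field
      encodes    : Encodes B W
      PhiN≡      : PhiN T ≡ psiList B ++ 0 ∷ psiList W
      label-B    : ∀ {x} → x ∈ psiList B → ∃ λ (i : Fin n) → x ≡ label i
      label-W    : ∀ {x} → x ∈ psiList W → ∃ λ (i : Fin n) → x ≡ label i
      label⇒∈    : ∀ (i : Fin n) → label i ∈ psiList B ⊎ label i ∈ psiList W
      distinct-B : Unique (psiList B)
      distinct-W : Unique (psiList W)
      disjoint   : ∀ {x} → x ∈ psiList B → x ∈ psiList W → ⊥

  open Top (Uniqueₚ.map⁺ suc-injective (Uniqueₚ.upTo⁺ n)) public

  private
    module B = ForestSpec blacks-spec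
    module W = ForestSpec whites-spec

    T-row : ∀ {x} → Data.Bool.T (LT.isRowL (toLT T) x) ⇔ colour x ≡ white
    T-row {x} with LT.isRowL (toLT T) x
    ... | true  = mk⇔ (λ _ → refl) (λ _ → _)
    ... | false = mk⇔ (λ ()) (λ ())

    T-col : ∀ {x} → Data.Bool.T (not (LT.isRowL (toLT T) x)) ⇔ colour x ≡ black
    T-col {x} with LT.isRowL (toLT T) x
    ... | true  = mk⇔ (λ ()) (λ ())
    ... | false = mk⇔ (λ _ → refl) (λ _ → _)

    free-colour : ∀ {p : ℕ → Bool} {c} → (∀ {x} → Data.Bool.T (p x) ⇔ colour x ≡ c) →
                  ∀ {x} → x ∈ filterᵇ p (Free (toLT T)) ⇔ (colour x ≡ c × IsRoot x)
    free-colour h = mk⇔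
      (λ x∈ → let (f , px) = to (∈-filterᵇ (Free (toLT T))) x∈ in to h px , to (∈-Free L₀-closed) f)
      (λ (e , r) → from (∈-filterᵇ (Free (toLT T))) (from (∈-Free L₀-closed) r , from h e))

    free-row : ∀ {x} → x ∈ filterᵇ (LT.isRowL (toLT T)) (Free (toLT T)) ⇔ (colour x ≡ white × IsRoot x)
    free-row = free-colour (λ {x} → T-row {x})

    free-col : ∀ {x} → x ∈ filterᵇ (λ l → not (LT.isRowL (toLT T) l)) (Free (toLT T)) ⇔ (colour x ≡ black × IsRoot x)
    free-col = free-colour (λ {x} → T-col {x})

  drawing : Drawing blacks whites
  drawing = record
    { encodes  = encodes
    ; PhiN≡    = refl
    ; label-B  = λ x∈ → to ∈-standardLabels (∈-blacks⇒label x∈)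
    ; label-W  = λ x∈ → to ∈-standardLabels (∈-whites⇒label x∈)
    ; label⇒∈  = label⇒∈
    ; distinct-B = B.distinct
    ; distinct-W = W.distinct
    ; disjoint = disjoint
    }
    where
    below-top : ∀ {p : ℕ → Bool} {x} → (∃ λ k → k ∈ filterᵇ p (Free (toLT T)) × Desc k x) → x ∈ standardLabels n
    below-top (k , k∈ , d) = Desc-closed L₀-closed (proj₁ (to (∈-filterᵇ (standardLabels n)) (proj₁ (to (∈-filterᵇ (Free (toLT T))) k∈)))) d

    ∈-blacks⇒label : ∀ {x} → x ∈ psiList blacks → x ∈ standardLabels n
    ∈-blacks⇒label x∈ = below-top (to B.letters x∈)

    ∈-whites⇒label : ∀ {x} → x ∈ psiList whites → x ∈ standardLabels n
    ∈-whites⇒label x∈ = below-top (to W.letters x∈)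

    label⇒∈ : ∀ (i : Fin n) → label i ∈ psiList blacks ⊎ label i ∈ psiList whites
    label⇒∈ i with has-root L₀-closed (label∈ i)
    ... | k , r , d with colour k in ck
    ...   | white = inj₂ (from W.letters (k , from free-row (ck , r) , d))
    ...   | black = inj₁ (from B.letters (k , from free-col (ck , r) , d))

    encodes : Encodes blacks whites
    encodes = record
      { ordered = tree (All.tabulate (label-positive ∘ ∈-blacks⇒label)) (All.tabulate (label-positive ∘ ∈-whites⇒label))
                       B.ordered W.ordered
      ; fit-B   = B.fit
      ; fit-W   = W.fit
      ; roots-B = mk⇔ (to free-col ∘ to B.∈-roots) (from B.∈-roots ∘ from free-col)
      ; roots-W = mk⇔ (to free-row ∘ to W.∈-roots) (from W.∈-roots ∘ from free-row)
      }
      where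
      label-positive : ∀ {x} → x ∈ standardLabels n → 0 < x
      label-positive x∈ with to ∈-standardLabels x∈
      ... | i , refl = z<s

    disjoint : ∀ {x} → x ∈ psiList blacks → x ∈ psiList whites → ⊥
    disjoint p q =
      let (k , k∈ , d) = to B.letters p
          (k′ , k′∈ , d′) = to W.letters q
      in two-colours (to free-col k∈) (to free-row k′∈) d d′
      where
      two-colours : ∀ {k k′ x} → colour k ≡ black × IsRoot k → colour k′ ≡ white × IsRoot k′ →
                    Desc k x → Desc k′ x → ⊥
      two-colours (c , r) (c′ , r′) d d′ with root-unique L₀-closed r r′ d d′
      ... | refl with () ← trans (sym c) c′

  -- The word is a permutation, and its statistics

  module _ {B W : List PTree} (D : Drawing B W) where
    open Drawing D
    open Encodes encodes

    private
      F : List PTree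
      F = node white 0 B ∷ W

    PhiN≡word : PhiN T ≡ psiList F
    PhiN≡word = trans PhiN≡ (sym (psiList-∷ {white} B W))

    PhiN-perm : IsPermOf (PhiN T) n
    PhiN-perm = subst (λ σ → IsPermOf σ n) (sym PhiN≡)
      (Uniqueₚ.++⁺ distinct-B (All.tabulate (λ { x∈ refl → zero∉W x∈ }) ∷ distinct-W) apart ,
       λ x → mk⇔ bounded complete)
      where
      zero∉B : 0 ∉ psiList B
      zero∉B p with label-B p
      ... | _ , ()
      zero∉W : 0 ∉ psiList W
      zero∉W p with label-W p
      ... | _ , ()
      apart : ∀ {x} → x ∈ psiList B × x ∈ 0 ∷ psiList W → ⊥
      apart (p , here refl) = zero∉B p
      apart (p , there q)   = disjoint p q
      bounded : ∀ {x} → x ∈ psiList B ++ 0 ∷ psiList W → x ≤ n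
      bounded x∈ with ∈-++⁻ (psiList B) x∈
      ... | inj₂ (here refl) = z≤n
      ... | inj₁ p with label-B p
      ...   | i , refl = toℕ<n i
      bounded x∈ | inj₂ (there p) with label-W p
      ...   | i , refl = toℕ<n i
      complete : ∀ {x} → x ≤ n → x ∈ psiList B ++ 0 ∷ psiList W
      complete x≤n with zero-or-label x≤n
      ... | inj₁ refl = ∈-insert (psiList B)
      ... | inj₂ (i , refl) with label⇒∈ i
      ...   | inj₁ p = ∈-++⁺ˡ p
      ...   | inj₂ p = ∈-++⁺ʳ (psiList B) (there p)

    private
      word-distinct : Unique (psiList F)
      word-distinct = subst Unique PhiN≡word (proj₁ PhiN-perm)

      -- The tableau's `colour` is meaningless at 0, which is not a label. The colouring of the word
      -- is therefore read off the forest, where 0 is white, and compared with `colour` on labels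
      -- only.
      word-fits : All (Fits (vertexColour F) (Child F)) F
      word-fits = vertex-fits F word-distinct

      colour-vertex : ∀ (i : Fin n) → colour (label i) ≡ vertexColour F (label i)
      colour-vertex i with word-fits | label⇒∈ i
      ... | fits _ _ φ ∷ _ | inj₁ p = proj₁ (Fits-determines B fit-B φ {label i} p)
      ... | _ ∷ φ          | inj₂ p = proj₁ (Fits-determines W fit-W φ {label i} p)

      steps : Steps (vertexColour F) (PhiN T)
      steps = subst (Steps (vertexColour F)) (trans (++-identityʳ (psiList F)) (sym PhiN≡word))
        (Steps-word ordered word-fits end [])

      label∈PhiN : ∀ (i : Fin n) → label i ∈ PhiN T
      label∈PhiN i = from (proj₂ PhiN-perm (label i)) (toℕ<n i)

    row⇔ascent : ∀ i → IsRow T i ⇔ Ascent (label i) (PhiN T)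
    row⇔ascent i = mk⇔
      (λ r → proj₁ (Steps-at steps (label∈PhiN i)) (trans (sym (colour-vertex i)) (to (colour-row {i}) r)))
      (λ a → from (colour-row {i}) (trans (colour-vertex i) (ascent⇒white {x = label i} steps a)))

    col⇔descent : ∀ i → IsCol T i ⇔ Descent (label i) (PhiN T)
    col⇔descent i = mk⇔
      (λ c → proj₂ (Steps-at steps (label∈PhiN i)) (trans (sym (colour-vertex i)) (to (colour-col {i}) c)))
      (λ d → from (colour-col {i}) (trans (colour-vertex i) (descent⇒black {x = label i} steps d)))

    freeRow⇔RLmin : ∀ i → IsFreeRow T i ⇔ RLmin (label i) (PhiN T)
    freeRow⇔RLmin i = mk⇔ f g
      where
      f : IsFreeRow T i → RLmin (label i) (PhiN T)
      f fr with to FreeRow⇔root fr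
      ... | r , root with root⇒extremal ordered
                            (there (from (roots-W) (to (colour-row {i}) r , root)))
      ...   | u , v , e , q = u , v , trans PhiN≡word e , q
      g : RLmin (label i) (PhiN T) → IsFreeRow T i
      g (u , v , e , q) with extremal⇒root {u = u} ordered (trans (sym PhiN≡word) e) q
      -- The first root is 0, which is no label, so the root found belongs to `W`.
      ... | there p with to (roots-W) p
      ...   | c , root = from FreeRow⇔root (from colour-row c , root)

    private
      ordered-B : Ordered black B
      ordered-B with ordered
      ... | tree _ _ o _ = o

    freeCol⇔shiftedRLmax : ∀ i → IsFreeCol T i ⇔ ShiftedRLmax (label i) (PhiN T)
    freeCol⇔shiftedRLmax i = mk⇔ f g
      where
      f : IsFreeCol T i → ShiftedRLmax (label i) (PhiN T)
      f fc with to FreeCol⇔root fc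
      ... | c , root = psiList B , psiList W , PhiN≡ ,
        root⇒extremal ordered-B (from (roots-B) (to (colour-col {i}) c , root))
      g : ShiftedRLmax (label i) (PhiN T) → IsFreeCol T i
      g (w₁ , w₂ , e₀ , u , v , e′ , q)
        -- The factorisation around 0 is arbitrary, but 0 occurs once in a permutation, so `w₁` is
        -- the word of the black trees.
        with split-unique (λ 0∈ → Unique-disjoint (psiList B) (subst Unique PhiN≡ (proj₁ PhiN-perm)) 0∈ (here refl))
                          (λ 0∈ → Unique-disjoint w₁ (subst Unique e₀ (proj₁ PhiN-perm)) 0∈ (here refl))
                          (trans (sym PhiN≡) e₀)
      ... | refl , _ with to (roots-B) (extremal⇒root {u = u} ordered-B e′ q)
      ...   | c , root = from FreeCol⇔root (from (colour-col {i}) c , root)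

-- Equal words come from equal forests, and a forest displays the colour and the children of every
-- label, hence the shape and every arrow.
PhiN-injective : ∀ {n} (T T′ : AltTableau n) → PhiN T ≡ PhiN T′ → shape T ≡ shape T′ × fill T ≡ fill T′
PhiN-injective T T′ e = same-fill (Tableau.drawing T) (Tableau.drawing T′)
  where
  module T = Tableau T
  module T′ = Tableau T′

  same-fill : ∀ {B W B′ W′} → T.Drawing B W → T′.Drawing B′ W′ → shape T ≡ shape T′ × fill T ≡ fill T′
  same-fill {B} {W} {B′} {W′} D D′ = lookupV-ext same-shape , lookupV-ext λ i → lookupV-ext λ j → same-entry i j
    where
    module D = T.Drawing D
    module D′ = T′.Drawing D′
    module E = T.Encodes D.encodes
    module E′ = T′.Encodes D′.encodes

    same-forest : B ≡ B′ × W ≡ W′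
    same-forest = node-injective (psiList-injective E.ordered E′.ordered
      (trans (sym (T.PhiN≡word D)) (trans e (T′.PhiN≡word D′))))
      where
      node-injective : ∀ {B W B′ W′} → node white 0 B ∷ W ≡ node white 0 B′ ∷ W′ → B ≡ B′ × W ≡ W′
      node-injective refl = refl , refl

    agree : ∀ i → T.colour (label i) ≡ T′.colour (label i) × (∀ b → T.Parent b (label i) ⇔ T′.Parent b (label i))
    agree i = [ Fits-determines B E.fit-B (subst (All _) (sym (proj₁ same-forest)) E′.fit-B)
              , Fits-determines W E.fit-W (subst (All _) (sym (proj₂ same-forest)) E′.fit-W) ]′ (D.label⇒∈ i)

    same-row : ∀ {i} → IsRow T i ⇔ IsRow T′ i
    same-row {i} = mk⇔ (λ r → from T′.colour-row (trans (sym (proj₁ (agree i))) (to T.colour-row r)))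
                       (λ r → from T.colour-row (trans (proj₁ (agree i)) (to T′.colour-row r)))

    same-shape : ∀ i → lookupV (shape T) i ≡ lookupV (shape T′) i
    same-shape i with lookupV (shape T) i | lookupV (shape T′) i | same-row {i}
    ... | true  | _     | h = sym (to h refl)
    ... | false | false | _ = refl
    ... | false | true  | h = from h refl

    arrow-ext : ∀ {a b} → a ≡ left ⇔ b ≡ left → a ≡ up ⇔ b ≡ up → a ≡ b
    arrow-ext {left} h _ = sym (to h refl)
    arrow-ext {up}   _ h = sym (to h refl)
    arrow-ext {emp} {emp}  _ _ = refl
    arrow-ext {emp} {left} h _ = from h refl
    arrow-ext {emp} {up}   _ h = from h refl

    same-entry : ∀ i j → entry (fill T) i j ≡ entry (fill T′) i j
    same-entry i j = arrow-ext
      (mk⇔ (λ e → let (r , p) = to T.entry-left e in from T′.entry-left (to same-row r , to (proj₂ (agree j) _) p))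
           (λ e → let (r , p) = to T′.entry-left e in from T.entry-left (from same-row r , from (proj₂ (agree j) _) p)))
      (mk⇔ (λ e → let (r , p) = to T.entry-up e in from T′.entry-up (to same-row r , to (proj₂ (agree i) _) p))
           (λ e → let (r , p) = to T′.entry-up e in from T.entry-up (from same-row r , from (proj₂ (agree i) _) p)))

-- The tableau of a forest

module FromForest {n : ℕ} {B W : List PTree} (o : Ordered white (node white 0 B ∷ W))
  (u : Unique (psiList (node white 0 B ∷ W))) (letters : ∀ x → x ∈ psiList (node white 0 B ∷ W) ⇔ x ≤ n)
  {col : ℕ → Color} {P : ℕ → ℕ → Set} (P? : ∀ b a → Dec (P b a))
  (F-fits : All (Fits col P) (node white 0 B ∷ W)) where

  private
    F : List PTree
    F = node white 0 B ∷ W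

    label∈F : ∀ (i : Fin n) → label i ∈ psiList F
    label∈F i = from (letters _) (toℕ<n i)

  -- Position (`i`, `j`) with `i` white gets a left arrow if `j` is the parent of `i`, an up arrow
  -- if `j` is a child of `i`. That `j` is then black and larger than `i`, so that the cell exists,
  -- is a property of ordered forests.
  arrow : ℕ → ℕ → Arrow
  arrow i j with col i | P? i j | P? j i
  ... | white | yes _ | _     = left
  ... | white | no _  | yes _ = up
  ... | white | no _  | no _  = emp
  ... | black | _     | _     = emp

  data ArrowView (i j : ℕ) : Arrow → Set where
    empty    : ArrowView i j emp
    leftward : col i ≡ white → P i j → ArrowView i j left
    upward   : col i ≡ white → P j i → ArrowView i j up

  arrow-view : ∀ i j → ArrowView i j (arrow i j)
  arrow-view i j with col i in e | P? i j | P? j i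
  ... | white | yes p | _     = leftward e p
  ... | white | no _  | yes p = upward e p
  ... | white | no _  | no _  = empty
  ... | black | _     | _     = empty

  left-view : ∀ {i j a} → ArrowView i j a → a ≡ left → P i j
  left-view (leftward _ p) _ = p

  up-view : ∀ {i j a} → ArrowView i j a → a ≡ up → P j i
  up-view (upward _ p) _ = p

  arrow-left : ∀ {i j} → col i ≡ white → P i j → arrow i j ≡ left
  arrow-left {i} {j} e p with col i | P? i j | P? j i
  ... | white | yes _ | _ = refl
  ... | white | no ¬p | _ = ⊥-elim (¬p p)

  arrow-up : ∀ {i j} → j ∈ psiList F → col i ≡ white → P j i → arrow i j ≡ up
  arrow-up {i} {j} j∈ e p with col i | P? i j | P? j i
  ... | white | no _  | yes _ = refl
  ... | white | no _  | no ¬p = ⊥-elim (¬p p)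
  -- Otherwise `j` would be its own grandchild and precede itself.
  ... | white | yes q | _     = ⊥-elim (<[]-irrefl (col j) (grandchild-of o F-fits j∈ q p))

  private
    is-white : Color → Bool
    is-white white = true
    is-white black = false

    fillF : Vec (Vec Arrow n) n
    fillF = Vec.tabulate λ i → Vec.tabulate λ j → arrow (label i) (label j)

    shapeF : Vec Bool n
    shapeF = Vec.tabulate λ i → is-white (col (label i))

    entryF : ∀ i j → entry fillF i j ≡ arrow (label i) (label j)
    entryF i j = trans (cong (λ v → lookupV v j) (lookupV-tabulate (λ i → Vec.tabulate λ j → arrow (label i) (label j)) i))
                       (lookupV-tabulate (λ j → arrow (label i) (label j)) j)

    shapeF-white : ∀ {i} → col (label i) ≡ white → lookupV shapeF i ≡ true
    shapeF-white {i} e = trans (lookupV-tabulate (λ i → is-white (col (label i))) i) (cong is-white e)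

    shapeF-black : ∀ {i} → col (label i) ≡ black → lookupV shapeF i ≡ false
    shapeF-black {i} e = trans (lookupV-tabulate (λ i → is-white (col (label i))) i) (cong is-white e)

    entry-view : ∀ i j → ArrowView (label i) (label j) (entry fillF i j)
    entry-view i j = subst (ArrowView (label i) (label j)) (sym (entryF i j)) (arrow-view (label i) (label j))

    child : ∀ {b} i → P b (label i) → b ∈ psiList F × col b ≡ opp (col (label i)) × b <[ col b ] label i
    child i = child-of o F-fits (label∈F i)

    child-white : ∀ {b i} → col b ≡ white → P b (label i) → col (label i) ≡ black × b < label i
    child-white {b} {i} e p with child i p
    ... | _ , e′ , l rewrite e with col (label i)
    ...   | black = refl , l

    child-black : ∀ {b i} → col (label i) ≡ white → P b (label i) → col b ≡ black × label i < b
    child-black {b} {i} e p with child i p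
    ... | _ , e′ , l rewrite e | e′ = refl , l

    one-parent : ∀ {i j : Fin n} {b} → P b (label i) → P b (label j) → toℕ i ≡ toℕ j
    one-parent {i} {j} p q = suc-injective (parent-unique o F-fits u (label∈F i) (label∈F j) p q)

  tableau : AltTableau n
  tableau = record { shape = shapeF ; fill = fillF ; onCells = onCellsF ; leftOK = leftOKF ; upOK = upOKF }
    where
    onCellsF : ∀ i j → entry fillF i j ≢ emp → CellExists shapeF i j
    onCellsF i j ne with entry fillF i j | entry-view i j
    ... | _ | empty = ⊥-elim (ne refl)
    ... | _ | leftward e p = let (e′ , l) = child-white {i = j} e p in
          shapeF-white e , shapeF-black e′ , ≤-pred l
    ... | _ | upward e p = let (e′ , l) = child-black {i = i} e p in
          shapeF-white e , shapeF-black e′ , ≤-pred l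
    leftOKF : ∀ i j j′ → entry fillF i j ≡ left → toℕ j < toℕ j′ → entry fillF i j′ ≡ emp
    leftOKF i j j′ eq l with entry fillF i j | entry-view i j | entry fillF i j′ | entry-view i j′
    ... | _ | leftward e p | _ | empty = refl
    -- Two left arrows would give `i` two parents. In the next case `j′` would be a grandchild of
    -- `j`, both black, hence the smaller of the two labels. Up arrows are treated in the same way
    -- with rows.
    ... | _ | leftward e p | _ | leftward _ q = ⊥-elim (<-irrefl (one-parent {j} {j′} p q) l)
    ... | _ | leftward e p | _ | upward _ q with grandchild-of o F-fits (label∈F j) p q
    ...   | l′ rewrite proj₁ (child-black {i = i} e q) = ⊥-elim (<-asym l (≤-pred l′))
    upOKF : ∀ i i′ j → entry fillF i j ≡ up → toℕ i′ < toℕ i → entry fillF i′ j ≡ emp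
    upOKF i i′ j eq l with entry fillF i j | entry-view i j | entry fillF i′ j | entry-view i′ j
    ... | _ | upward e p | _ | empty = refl
    ... | _ | upward e p | _ | upward _ q = ⊥-elim (<-irrefl (one-parent {i′} {i} q p) l)
    ... | _ | upward e p | _ | leftward e′ q with grandchild-of o F-fits (label∈F i) p q
    ...   | l′ rewrite e′ = ⊥-elim (<-asym l (≤-pred l′))

  private
    module T = Tableau tableau

    colour-agrees : ∀ (i : Fin n) → col (label i) ≡ T.colour (label i)
    colour-agrees i with col (label i) in e
    ... | white = sym (to (T.colour-row {i}) (shapeF-white e))
    ... | black = sym (to (T.colour-col {i}) (shapeF-black e))

    0∈roots : 0 ∈ roots F
    0∈roots = here refl

    non-root : ∀ {b a} → a ∈ psiList F → P b a → ∃ λ (i : Fin n) → b ≡ label i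
    non-root {b} a∈ p with zero-or-label (to (letters _) (proj₁ (child-of o F-fits a∈ p)))
    ... | inj₁ refl = ⊥-elim (child∉roots o F-fits u a∈ p 0∈roots)
    ... | inj₂ q    = q

    child⇒parent : ∀ {b} (j : Fin n) → P b (label j) → T.Parent b (label j)
    child⇒parent j p with non-root (label∈F j) p
    ... | i , refl with col (label i) in e
    ...   | white = proj₂ (to (T.entry-left {i} {j}) (trans (entryF i j) (arrow-left e p)))
    ...   | black = proj₂ (to (T.entry-up {j} {i}) (trans (entryF j i) (arrow-up (label∈F i) white-j p)))
      where
      white-j : col (label j) ≡ white
      white-j = trans (sym (opp-involutive _)) (cong opp (trans (sym (proj₁ (proj₂ (child j p)))) e))

    parent⇒child : ∀ {b} (j : Fin n) → T.Parent b (label j) → P b (label j)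
    parent⇒child j p with to ∈-standardLabels (proj₁ p)
    ... | i , refl = by-colour (T.colour (label i)) refl
      where
      by-colour : ∀ c → T.colour (label i) ≡ c → P (label i) (label j)
      by-colour white e = left-view (entry-view i j) (from (T.entry-left {i} {j}) (from (T.colour-row {i}) e , p))
      by-colour black e = up-view (entry-view j i) (from (T.entry-up {j} {i}) (from (T.colour-row {j}) white-j , p))
        where
        white-j : T.colour (label j) ≡ white
        white-j = trans (sym (opp-involutive _)) (cong opp (trans (sym (T.Parent-colour p)) e))

    agrees : ∀ (i : Fin n) → col (label i) ≡ T.colour (label i) × (∀ b → P b (label i) ⇔ T.Parent b (label i))
    agrees i = colour-agrees i , λ b → mk⇔ (child⇒parent i) (parent⇒child i)

    ∈B⇒label : ∀ {x} → x ∈ psiList B → ∃ λ (i : Fin n) → x ≡ label i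
    ∈B⇒label x∈ with zero-or-label (to (letters _) (∈-word-sub {white} B W x∈))
    ... | inj₁ refl = ⊥-elim (DistinctNode.root∉sub (distinct-node {white} {0} {B} {W} u) x∈)
    ... | inj₂ q    = q

    ∈W⇒label : ∀ {x} → x ∈ psiList W → ∃ λ (i : Fin n) → x ≡ label i
    ∈W⇒label x∈ with zero-or-label (to (letters _) (∈-word-rest {white} B W x∈))
    ... | inj₁ refl = ⊥-elim (DistinctNode.root∉rest (distinct-node {white} {0} {B} {W} u) x∈)
    ... | inj₂ q    = q

    under-zero : ∀ {b} → P b 0 ⇔ b ∈ roots B
    under-zero {b} = children F-fits b
      where
      children : ∀ {us ts} → All (Fits col P) (node white 0 us ∷ ts) → ∀ b → P b 0 ⇔ b ∈ roots us
      children (fits _ k _ ∷ _) = k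

    B-fits : All (Fits col P) B
    B-fits = subforest F-fits
      where
      subforest : ∀ {us ts} → All (Fits col P) (node white 0 us ∷ ts) → All (Fits col P) us
      subforest (fits _ _ φ ∷ _) = φ

    B-ordered : Ordered black B
    B-ordered = subforest o
      where
      subforest : ∀ {us ts} → Ordered white (node white 0 us ∷ ts) → Ordered black us
      subforest (tree _ _ o _) = o

    -- In the forest a label is an outer root, a child of 0, or a child of another label. Only the
    -- last produces an arrow, and so a parent in the tableau.
    classify : ∀ {x} → T.IsRoot x → x ∈ roots B ⊎ x ∈ roots W
    classify (x∈ , no-parent) with to ∈-standardLabels x∈
    ... | i , refl with root-or-child F-fits (label∈F i)
    ...   | inj₁ (there p) = inj₂ p
    ...   | inj₂ (a , a∈ , p) with zero-or-label (to (letters a) a∈)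
    ...     | inj₁ refl = inj₁ (to under-zero p)
    ...     | inj₂ (j , refl) = ⊥-elim (no-parent (label∈ j) (child⇒parent j p))

    B-root : ∀ {x} → x ∈ roots B → T.colour x ≡ black × T.IsRoot x
    B-root {x} x∈ with ∈B⇒label (∈-roots⇒∈-word B x∈)
    ... | i , refl =
      trans (sym (colour-agrees i)) (roots-coloured B-ordered B-fits x∈) , label∈ i , no-parent
      where
      no-parent : ∀ {a} → a ∈ standardLabels n → ¬ T.Parent x a
      no-parent a∈ p with to ∈-standardLabels a∈
      -- In the forest the parent of `x` is 0; a parent in the tableau would be a second one, with
      -- positive label.
      ... | j , refl with parent-unique o F-fits u (∈-word-root {white} B W) (label∈F j)
                            (from under-zero x∈) (parent⇒child j p)
      ...   | ()

    W-root : ∀ {x} → x ∈ roots W → T.colour x ≡ white × T.IsRoot x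
    W-root {x} x∈ with ∈W⇒label (∈-roots⇒∈-word W x∈)
    ... | i , refl = trans (sym (colour-agrees i)) (roots-coloured o F-fits (there x∈)) , label∈ i , no-parent
      where
      no-parent : ∀ {a} → a ∈ standardLabels n → ¬ T.Parent x a
      no-parent a∈ p with to ∈-standardLabels a∈
      ... | j , refl = child∉roots o F-fits u (label∈F j) (parent⇒child j p) (there x∈)

  tableau-encodes : T.Encodes B W
  tableau-encodes = record
    { ordered = o
    ; fit-B   = Fits-cong B (λ x∈ → agree (∈B⇒label x∈)) B-fits
    ; fit-W   = Fits-cong W (λ x∈ → agree (∈W⇒label x∈)) (All.tail F-fits)
    ; roots-B = mk⇔ B-root λ (c , r) → only-B c (classify r)
    ; roots-W = mk⇔ W-root λ (c , r) → only-W c (classify r)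
    }
    where
    agree : ∀ {x} → (∃ λ (i : Fin n) → x ≡ label i) → col x ≡ T.colour x × (∀ b → P b x ⇔ T.Parent b x)
    agree (i , refl) = agrees i
    only-B : ∀ {x} → T.colour x ≡ black → x ∈ roots B ⊎ x ∈ roots W → x ∈ roots B
    only-B c (inj₁ p) = p
    only-B c (inj₂ p) with () ← trans (sym c) (proj₁ (W-root p))
    only-W : ∀ {x} → T.colour x ≡ white → x ∈ roots B ⊎ x ∈ roots W → x ∈ roots W
    only-W c (inj₂ p) = p
    only-W c (inj₁ p) with () ← trans (sym c) (proj₁ (B-root p))

  PhiN-tableau : PhiN tableau ≡ psiList F
  PhiN-tableau = word≡ T.drawing
    where
    word≡ : ∀ {B′ W′} → T.Drawing B′ W′ → PhiN tableau ≡ psiList F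
    word≡ D with T.Encodes-unique (T.Drawing.encodes D) tableau-encodes
    ... | refl , refl = T.PhiN≡word D

PhiN-surjective : ∀ {n} σ → IsPermOf σ n → Σ (AltTableau n) λ T → PhiN T ≡ σ
PhiN-surjective {n} σ (u , letters) with psiList-surjective (length σ) white σ ≤-refl u
... | F , o , refl = from-forest F o u letters
  where
  from-forest : ∀ F → Ordered white F → Unique (psiList F) → (∀ x → x ∈ psiList F ⇔ x ≤ n) →
                Σ (AltTableau n) λ T → PhiN T ≡ psiList F
  from-forest [] _ _ letters with from (letters 0) z≤n
  ... | ()
  from-forest (node .white m B ∷ W) o@(tree a b _ _) u letters with ∈-word⁻ {white} B W (from (letters 0) z≤n)
  -- The letter 0 must be the first root: anywhere else, the first root would be a number less than
  -- 0.
  ... | inj₁ p with () ← All.lookup a p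
  ... | inj₂ (inj₂ p) with () ← All.lookup b p
  ... | inj₂ (inj₁ refl) = M.tableau , M.PhiN-tableau
    where
    module M = FromForest o u letters (Child? (node white 0 B ∷ W)) (vertex-fits (node white 0 B ∷ W) u)

theorem5p4 : (n : ℕ) →
    ((T : AltTableau n) → IsPermOf (PhiN T) n)
    × ((T T′ : AltTableau n) → PhiN T ≡ PhiN T′ → (shape T ≡ shape T′) × (fill T ≡ fill T′))
    × ((σ : List ℕ) → IsPermOf σ n → Σ (AltTableau n) (λ T → PhiN T ≡ σ))
    × ((T : AltTableau n) (i : Fin n) →
    (IsRow T i ⇔ Ascent (suc (toℕ i)) (PhiN T))
    × (IsCol T i ⇔ Descent (suc (toℕ i)) (PhiN T))
    × (IsFreeRow T i ⇔ RLmin (suc (toℕ i)) (PhiN T))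
    × (IsFreeCol T i ⇔ ShiftedRLmax (suc (toℕ i)) (PhiN T)))
theorem5p4 n =
  (λ T → Tableau.PhiN-perm T (Tableau.drawing T)) ,
  PhiN-injective ,
  PhiN-surjective ,
  λ T i → let D = Tableau.drawing T in
    Tableau.row⇔ascent T D i , Tableau.col⇔descent T D i ,
    Tableau.freeRow⇔RLmin T D i , Tableau.freeCol⇔shiftedRLmax T D i
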